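{- Let $k\in\mathbb{N}$, let $\mathcal{G}$ be a graph class (with a membership test) containing only cubic graphs, all with at least $k+1$ vertices, and let $\mathcal{U}$ be a finite set of graphs. Consider the symmetry-breaking algorithm described in the context, modified as follows: whenever a pair $(U,H)$ is processed such that $U$ contains a vertex of degree at least $2$ in $H$, then in step (b), instead of iterating over a set $\overline{U}$ of representatives of all orbits, only a single (arbitrarily chosen) vertex $u\in U$ with $\deg_H(u)\ge 2$ is considered. Then the modified algorithm is still correct: if it returns a graph, this graph is in $\mathcal{G}^k\setminus\mathrm{super}(\mathcal{U})$, and if it returns NONE, then $\mathcal{G}^k\subseteq\mathrm{super}(\mathcal{U})$.
   Context: Graphs are non-empty, finite and simple; graph classes are closed under isomorphism. A path-decomposition of $G$ is a sequence of bags $V_1,\dots,V_{n'}\subseteq V(G)$ such that every vertex lies in some bag, both ends of every edge lie together in some bag, and for each vertex the indices of the bags containing it form an interval. Its width is $\max_i|V_i|-1$; path-width is the minimum width. A path-decomposition of width $k$ is smooth if all bags have $k+1$ elements and $|V_i\cap V_{i+1}|=k$ for $1\le i<n'$. The graph associated with $V_i$ is $G_i := G[\bigcup_{1\le j\le i}V_j]-E(G[V_i])$. $\mathcal{G}^k$ is the class of graphs in $\mathcal{G}$ of path-width at most $k$; $\mathrm{super}(\mathcal{U})$ is the class of all graphs that contain a subgraph isomorphic to some member of $\mathcal{U}$. For a smooth path-decomposition (of width $k$) of $G$ with bags $V_1,\dots,V_{n'}$ and each $i$, we say that $G$ contains the pair $(V_i,G_i)$. A pair $(U,H)$ is good if every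 $G\in\mathcal{G}^k$ containing it satisfies $G\in\mathrm{super}(\mathcal{U})$. $\mathrm{Aut}(U,H)$ denotes the group of automorphisms $\varphi$ of $H$ with $\varphi(U)=U$. Symmetry-breaking algorithm, with vertices named $u_1,\dots,u_k,v_1,v_2,\dots$: 1. Set $V_1:=\{u_1,\dots,u_k,v_1\}$ and initialise a queue $Q$ with the single pair $(V_1,(V_1,\emptyset))$, where $(V_1,\emptyset)$ is the edgeless graph on $V_1$. If this pair is good, remove it from $Q$. 2. While $Q$ is not empty: remove a pair $(U,H)$ from $Q$ and determine $\mathrm{Aut}(U,H)$. (a) Let $\mathcal{F}$ be the set of all subsets of $\{xy:x,y\in U,x\neq y\}$. While $\mathcal{F}\neq\emptyset$: remove some $E'$ from $\mathcal{F}$; if $H+E'\in\mathcal{G}\setminus\mathrm{super}(\mathcal{U})$, return $H+E'$ and stop; otherwise remove all sets $\varphi(E')$, $\varphi\in\mathrm{Aut}(U,H)$, from $\mathcal{F}$. (b) Let $i=|V(H)|-k$ and let $\overline{U}\subseteq U$ contain one vertex from every orbit of $\mathrm{Aut}(U,H)$ on $U$. For each $u\in\overline{U}$: set $U':=(U\setminus\{u\})\cup\{v_{i+1}\}$ and let $\mathcal{Y}$ be the set of all subsets of $U\setminus\{u\}$. While $\mathcal{Y}\neq\emptyset$: remove some $Y$ from $\mathcal{Y}$; set $H':=H+v_{i+1}+\{uy:y\in Y\}$; if $H'\notin\mathrm{super}(\mathcal{U})$, and there exists $G\in\mathcal{G}$ containing $(U',H')$, and there is no bijection $\varphi$ with $(\varphi(U'),\varphi(H'))\in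 Q$, then append $(U',H')$ to $Q$; then remove all sets $\varphi(Y)$ with $\varphi\in\mathrm{Aut}(U,H)$, $\varphi(u)=u$, from $\mathcal{Y}$. 3. Return NONE. -}

module Defs where

open import Data.Bool using (Bool; false; T; _∧_; _∨_)
open import Data.Bool.Properties using (∨-comm)
open import Data.Empty using (⊥-elim)
open import Data.Fin as Fin using (Fin; zero; suc; toℕ; _≟_)
open import Data.Fin.Permutation using (Permutation; _⟨$⟩ʳ_)
open import Data.Fin.Subset
  using (Subset; inside; _∈_; _∉_; _⊆_; _∩_; _-_; ∣_∣; ⁅_⁆; Empty)
  renaming (⊤ to full)
open import Data.Fin.Subset.Properties using (_∈?_)
open import Data.List using (List; []; _∷_; _++_; _∷ʳ_)
open import Data.List.Relation.Unary.Any using (Any)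
open import Data.Maybe using (Maybe; just; nothing)
open import Data.Nat using (ℕ; suc; _≤_; _<_; _∸_; _⊔_; NonZero)
open import Data.Nat.Properties using (≤-trans; ≤-reflexive)
open import Data.Product using (Σ-syntax; ∃; ∃-syntax; _×_; _,_)
open import Data.Vec using (tabulate; _∷_)
open import Data.Vec.Functional using (foldr)
open import Function.Bundles using (_⇔_; mk⇔)
open import Function.Definitions using (Injective)
open import Level using (0ℓ)
open import Relation.Binary.PropositionalEquality
  using (_≡_; refl; cong₂)
open import Relation.Nullary using (¬_; yes; no)
open import Relation.Nullary.Decidable using (⌊_⌋)
open import Relation.Unary using (Pred; Decidable) renaming (Empty to EmptyPred; U to Univ)

-- Non-empty finite simple graphs; every such graph has a copy on some Fin n.
record Graph : Set where
  field
    order       : ℕ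
    ⦃ nonEmpty ⦄ : NonZero order
    adj         : Fin order → Fin order → Bool
    symmetric   : ∀ x y → adj x y ≡ adj y x
    irreflexive : ∀ x → adj x x ≡ false

  Vertex : Set
  Vertex = Fin order

  Adj : Vertex → Vertex → Set
  Adj x y = T (adj x y)

  neighbours : Vertex → Subset order
  neighbours x = tabulate (adj x)

  degree : Vertex → ℕ
  degree x = ∣ neighbours x ∣

open Graph public

Cubic : Graph → Set
Cubic G = ∀ x → degree G x ≡ 3

_≅_ : Graph → Graph → Set
G ≅ H = Σ[ φ ∈ Permutation (order G) (order H) ]
  ∀ x y → adj H (φ ⟨$⟩ʳ x) (φ ⟨$⟩ʳ y) ≡ adj G x y

record GraphClass : Set₁ where
  field
    Member  : Graph → Set
    member? : Decidable Member
    closed  : ∀ {G H} → G ≅ H → Member G → Member H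

open GraphClass public

-- G has a subgraph (not necessarily induced) isomorphic to F; the subgraph
-- is the image of the injection.
ContainsCopy : Graph → Graph → Set
ContainsCopy G F = Σ[ f ∈ (Vertex F → Vertex G) ]
  Injective _≡_ _≡_ f × (∀ x y → Adj F x y → Adj G (f x) (f y))

Super : List Graph → Graph → Set
Super 𝒰 G = Any (ContainsCopy G) 𝒰

record PathDecomposition (G : Graph) : Set where
  field
    length   : ℕ
    bag      : Fin length → Subset (order G)
    vertices : ∀ x → ∃[ i ] x ∈ bag i
    edges    : ∀ x y → Adj G x y → ∃[ i ] (x ∈ bag i × y ∈ bag i)
    interval : ∀ x i j l → i Fin.≤ j → j Fin.≤ l →
               x ∈ bag i → x ∈ bag l → x ∈ bag j

  width : ℕ
  width = foldr _⊔_ 0 (λ i → ∣ bag i ∣) ∸ 1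

open PathDecomposition public

record IsPathWidth (G : Graph) (w : ℕ) : Set where
  field
    attained : Σ[ D ∈ PathDecomposition G ] width D ≡ w
    minimal  : (D : PathDecomposition G) → w ≤ width D

PathWidthAtMost : ℕ → Graph → Set
PathWidthAtMost k G = Σ[ D ∈ PathDecomposition G ] width D ≤ k

pathWidthAtMost⇔ : ∀ {G w k} → IsPathWidth G w → PathWidthAtMost k G ⇔ w ≤ k
pathWidthAtMost⇔ pw = mk⇔
  (λ (D , D≤k) → ≤-trans (minimal D) D≤k)
  (λ w≤k → let (D , eq) = attained in D , ≤-trans (≤-reflexive eq) w≤k)
  where open IsPathWidth pw

record IsSmooth (k : ℕ) {G : Graph} (D : PathDecomposition G) : Set where
  field
    width≡   : width D ≡ k
    bagSize  : ∀ i → ∣ bag D i ∣ ≡ suc k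
    adjacent : ∀ i j → toℕ j ≡ suc (toℕ i) → ∣ bag D i ∩ bag D j ∣ ≡ k

-- The graph  G_i = G[V_1 ∪ … ∪ V_i] − E(G[V_i]),  as a vertex set and an edge
-- relation inside G.
AssociatedVertex : ∀ {G} (D : PathDecomposition G) → Fin (length D) → Vertex G → Set
AssociatedVertex D i x = ∃[ j ] (j Fin.≤ i × x ∈ bag D j)

AssociatedAdj : ∀ {G} (D : PathDecomposition G) → Fin (length D) →
                Vertex G → Vertex G → Set
AssociatedAdj {G} D i x y =
  AssociatedVertex D i x × AssociatedVertex D i y × Adj G x y ×
  ¬ (x ∈ bag D i × y ∈ bag D i)

record Pair : Set where
  constructor pair
  field
    graph : Graph
    part  : Subset (order graph)

open Pair public

-- (φ(U) , φ(H)) = (U′ , H′)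
record IsPairIso (P P′ : Pair)
                 (φ : Permutation (order (graph P)) (order (graph P′))) : Set where
  field
    graphIso : ∀ x y → adj (graph P′) (φ ⟨$⟩ʳ x) (φ ⟨$⟩ʳ y) ≡ adj (graph P) x y
    partIso  : ∀ x → x ∈ part P ⇔ (φ ⟨$⟩ʳ x) ∈ part P′

_≅ₚ_ : Pair → Pair → Set
P ≅ₚ P′ = ∃ (IsPairIso P P′)

Aut : Pair → Set
Aut P = P ≅ₚ P

act : ∀ {P} → Aut P → Vertex (graph P) → Vertex (graph P)
act (φ , _) x = φ ⟨$⟩ʳ x

-- (U , H) is, up to renaming its vertices, the pair (V_i , G_i).
record IsCopyOf (P : Pair) {G : Graph} (D : PathDecomposition G)
                (i : Fin (length D)) : Set where
  field
    name      : Vertex (graph P) → Vertex G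
    injective : Injective _≡_ _≡_ name
    onto      : ∀ y → (∃[ x ] name x ≡ y) ⇔ AssociatedVertex D i y
    part⇔     : ∀ x → x ∈ part P ⇔ name x ∈ bag D i
    adj⇔      : ∀ x y → Adj (graph P) x y ⇔ AssociatedAdj D i (name x) (name y)

ContainsPair : ℕ → Graph → Pair → Set
ContainsPair k G P =
  Σ[ D ∈ PathDecomposition G ] IsSmooth k D × (∃[ i ] IsCopyOf P D i)

-- A set of two-element subsets {x , y} of U.
record EdgeSet {n : ℕ} (U : Subset n) : Set where
  field
    mem         : Fin n → Fin n → Bool
    symmetric   : ∀ x y → mem x y ≡ mem y x
    irreflexive : ∀ x → mem x x ≡ false
    within      : ∀ x y → T (mem x y) → x ∈ U × y ∈ U

-- H + E′
addEdges : (H : Graph) {U : Subset (order H)} → EdgeSet U → Graph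
addEdges H E′ = record
  { order       = order H
  ; nonEmpty    = nonEmpty H
  ; adj         = λ x y → adj H x y ∨ E.mem x y
  ; symmetric   = λ x y → cong₂ _∨_ (symmetric H x y) (E.symmetric x y)
  ; irreflexive = λ x → cong₂ _∨_ (irreflexive H x) (E.irreflexive x)
  }
  where module E = EdgeSet E′

-- H + v + {u y : y ∈ Y}.  The fresh vertex v is `zero`, and the old vertex x
-- is from now on called `suc x`.
addVertex : (H : Graph) (u : Vertex H) (Y : Subset (order H)) → u ∉ Y → Graph
addVertex H u Y u∉Y = record
  { order       = suc (order H)
  ; adj         = adj′
  ; symmetric   = sym′
  ; irreflexive = irr′
  }
  where
  new : Vertex H → Vertex H → Bool
  new x y = ⌊ x ≟ u ⌋ ∧ ⌊ y ∈? Y ⌋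

  new-irr : ∀ x → new x x ≡ false
  new-irr x with x ≟ u | x ∈? Y
  ... | no _     | _       = refl
  ... | yes _    | no _    = refl
  ... | yes refl | yes u∈Y = ⊥-elim (u∉Y u∈Y)

  adj′ : Fin (suc (order H)) → Fin (suc (order H)) → Bool
  adj′ (suc x) (suc y) = adj H x y ∨ (new x y ∨ new y x)
  adj′ _       _       = false

  sym′ : ∀ x y → adj′ x y ≡ adj′ y x
  sym′ zero    zero    = refl
  sym′ zero    (suc y) = refl
  sym′ (suc x) zero    = refl
  sym′ (suc x) (suc y) = cong₂ _∨_ (symmetric H x y) (∨-comm (new x y) (new y x))

  irr′ : ∀ x → adj′ x x ≡ false
  irr′ zero    = refl
  irr′ (suc x) = cong₂ _∨_ (irreflexive H x) (cong₂ _∨_ (new-irr x) (new-irr x))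

-- (U′ , H′)
extend : (P : Pair) (u : Vertex (graph P)) (Y : Subset (order (graph P))) →
         u ∉ Y → Pair
extend P u Y u∉Y = pair (addVertex (graph P) u Y u∉Y) (inside ∷ (part P - u))

-- (V₁ , (V₁ , ∅))  with  V₁ = {u₁ , … , u_k , v₁}
initialPair : ℕ → Pair
initialPair k = pair
  (record { order       = suc k
          ; adj         = λ _ _ → false
          ; symmetric   = λ _ _ → refl
          ; irreflexive = λ _ → refl })
  full

-- The algorithm is nondeterministic; a value of one of the types below is a
-- terminating execution.  The sets from which elements are successively removed
-- are represented by predicates, and tests whose outcome is not assumed to be
-- decidable occur as a premise or as a negated premise.

module Algorithm (k : ℕ) (𝒢 : GraphClass) (𝒰 : List Graph) where

  𝒢ᵏ : Graph → Set
  𝒢ᵏ G = Member 𝒢 G × PathWidthAtMost k G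

  Good : Pair → Set
  Good P = ∀ G → 𝒢ᵏ G → ContainsPair k G P → Super 𝒰 G

  data Initial : List Pair → Set where
    keep : ¬ Good (initialPair k) → Initial (initialPair k ∷ [])
    drop :   Good (initialPair k) → Initial []

  module _ (P : Pair) where

    private
      H = graph P
      U = part P
      n = order H

    Hit : EdgeSet U → Set
    Hit E′ = Member 𝒢 (addEdges H E′) × ¬ Super 𝒰 (addEdges H E′)

    _≐_ : EdgeSet U → EdgeSet U → Set
    E ≐ E′ = ∀ x y → EdgeSet.mem E x y ≡ EdgeSet.mem E′ x y

    -- E = φ(E′)
    IsEdgeImage : Aut P → EdgeSet U → EdgeSet U → Set
    IsEdgeImage φ E′ E =
      ∀ x y → EdgeSet.mem E (act φ x) (act φ y) ≡ EdgeSet.mem E′ x y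

    -- The result `nothing` means that 𝓕 was exhausted without a return.
    data StepA (𝓕 : Pred (EdgeSet U) 0ℓ) : Maybe Graph → Set₁ where
      exhausted : EmptyPred 𝓕 → StepA 𝓕 nothing
      return    : ∀ E′ → 𝓕 E′ → Hit E′ → StepA 𝓕 (just (addEdges H E′))
      discard   : ∀ {r} E′ → 𝓕 E′ → ¬ Hit E′ →
                  StepA (λ E → 𝓕 E × ¬ (E ≐ E′) × ¬ (∃[ φ ] IsEdgeImage φ E′ E)) r →
                  StepA 𝓕 r

    SameOrbit : Vertex H → Vertex H → Set
    SameOrbit x y = Σ[ φ ∈ Aut P ] act φ x ≡ y

    record IsTransversal (W : Subset n) : Set where
      field
        within : W ⊆ U
        meets  : ∀ x → x ∈ U → ∃[ w ] (w ∈ W × SameOrbit x w)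
        once   : ∀ v w → v ∈ W → w ∈ W → SameOrbit v w → v ≡ w

    data Candidates : Subset n → Set where
      single : ∀ u → u ∈ U → 2 ≤ degree H u → Candidates ⁅ u ⁆
      orbits : ∀ W → (∀ u → u ∈ U → degree H u < 2) → IsTransversal W → Candidates W

    Accept : List Pair → Pair → Set
    Accept Q P′ =
      ¬ Super 𝒰 (graph P′) ×
      (∃[ G ] (Member 𝒢 G × ContainsPair k G P′)) ×
      ¬ Any (P′ ≅ₚ_) Q

    data Append (Q : List Pair) (P′ : Pair) : List Pair → Set where
      append :   Accept Q P′ → Append Q P′ (Q ∷ʳ P′)
      skip   : ¬ Accept Q P′ → Append Q P′ Q

    -- Z = φ(Y)
    IsImage : Aut P → Subset n → Subset n → Set
    IsImage φ Y Z = ∀ x → x ∈ Y ⇔ act φ x ∈ Z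

    -- The loops are relations between the queue before and the queue after.
    data LoopY (u : Vertex H) (𝒴 : Pred (Subset n) 0ℓ) (Q : List Pair) :
               List Pair → Set₁ where
      done : EmptyPred 𝒴 → LoopY u 𝒴 Q Q
      step : ∀ {Q′ Q″} Y (u∉Y : u ∉ Y) → 𝒴 Y →
             Append Q (extend P u Y u∉Y) Q′ →
             LoopY u (λ Z → 𝒴 Z × ¬ (Z ≡ Y) ×
                            ¬ (Σ[ φ ∈ Aut P ] act φ u ≡ u × IsImage φ Y Z)) Q′ Q″ →
             LoopY u 𝒴 Q Q″

    data LoopU (W : Subset n) (Q : List Pair) : List Pair → Set₁ where
      done : Empty W → LoopU W Q Q
      step : ∀ {Q′ Q″} u → u ∈ W →
             LoopY u (_⊆ (U - u)) Q Q′ → LoopU (W - u) Q′ Q″ → LoopU W Q Q″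

    data StepB (Q Q′ : List Pair) : Set₁ where
      stepB : ∀ {W} → Candidates W → LoopU W Q Q′ → StepB Q Q′

  -- `nothing` stands for NONE.
  data Loop : List Pair → Maybe Graph → Set₁ where
    none     : Loop [] nothing
    found    : ∀ Q₁ P Q₂ {G} → StepA P Univ (just G) → Loop (Q₁ ++ P ∷ Q₂) (just G)
    continue : ∀ Q₁ P Q₂ {Q r} → StepA P Univ nothing → StepB P (Q₁ ++ Q₂) Q →
               Loop Q r → Loop (Q₁ ++ P ∷ Q₂) r

  data Execution (r : Maybe Graph) : Set₁ where
    execution : ∀ {Q} → Initial Q → Loop Q r → Execution r

{-# OPTIONS --safe #-}

-- A path-decomposition of width at most k amounts to an order of the vertices
-- in which every initial segment S with at least k + 1 vertices has at most k
-- vertices with a neighbour outside S.  A bag U ⊆ S of k + 1 vertices containing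
-- all of these can then drop any u ∈ U whose neighbours all lie in S, whatever
-- the next vertex v is.
--
-- If G is not in super(𝒰), the queue always contains a pair of such a partial
-- decomposition of G.  The only obstacle is a prescribed u with deg_H(u) ≥ 2
-- whose last neighbour w is outside S.  But the vertex v that entered last has
-- no edge in H, so w could have entered in its place with the same pair as a
-- result: now u can leave, and v enters next.  Moving w forward is harmless, as w
-- takes the place of u among the vertices with a neighbour outside.
module Submission where

open import Defs
open import Data.List using (List)
open import Data.Maybe using (Maybe; just; nothing)
open import Data.Nat using (ℕ; suc; _≤_)
open import Data.Product using (_×_)
open import Relation.Binary.PropositionalEquality using (_≡_)
open import Relation.Nullary using (¬_)

open import Data.Bool using (Bool; true; false; T; _∧_; _∨_)
open import Data.Bool.Properties using (T-≡; T-∧; T-∨)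
open import Data.Empty using (⊥; ⊥-elim)
open import Data.Fin as Fin using (Fin; zero; suc; toℕ; finToFun; funToFin)
open import Data.Fin.Permutation as Perm
  using (_⟨$⟩ʳ_; _⟨$⟩ˡ_; permutation; inverseˡ; inverseʳ)
open import Data.Fin.Properties as Finₚ using (_≟_; any?; all?; finToFun-funToFin)
open import Data.Fin.Subset
  using (Subset; inside; outside; _∈_; _∉_; _⊆_; _∩_; _∪_; _-_; ∣_∣; ⁅_⁆)
  renaming (⊤ to everything; ⊥ to ∅)
open import Data.Fin.Subset.Properties
open import Data.List using (_∷ʳ_; _++_; []; _∷_)
open import Data.List.Relation.Unary.All as All using (All; []; _∷_)
import Data.List.Relation.Unary.All.Properties as All
open import Data.List.Relation.Unary.Any as Any using (Any; here; there)
import Data.List.Relation.Unary.Any.Properties as Any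
open import Data.Nat using (zero; _+_; _∸_; _⊔_; _<_; z≤n; s≤s; s≤s⁻¹)
open import Data.Nat.Properties as ℕₚ using (≤-trans; ≤-reflexive; suc-injective)
open import Data.Product using (Σ-syntax; ∃; ∃-syntax; _,_; proj₁; proj₂)
open import Data.Sum using (_⊎_; inj₁; inj₂; [_,_]′)
open import Data.Vec using ([]; _∷_; tabulate; here; there)
open import Data.Vec.Functional using (foldr)
open import Data.Vec.Properties using (lookup∘tabulate; lookup⇒[]=; []=⇒lookup)
open import Function.Base using (_∘_; id)
open import Function.Bundles using (_⇔_; mk⇔; Equivalence)
open import Function.Definitions using (Injective)
open import Level using (0ℓ)
open import Relation.Binary.PropositionalEquality
  using (_≢_; refl; sym; trans; cong; cong₂; subst; subst₂)
open import Relation.Nullary using (Dec; yes; no; contradiction)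
open import Relation.Nullary.Decidable
  using (⌊_⌋; map′; _×-dec_; _→-dec_; ¬?; T?; toWitness; fromWitness;
         decidable-stable; ¬¬-excluded-middle)
open import Relation.Unary using (Pred; Decidable) renaming (U to Univ)
open Equivalence using (to; from)

-- Booleans as propositions, and sizes of finite subsets.

T-ext : ∀ {a b} → (T a → T b) → (T b → T a) → a ≡ b
T-ext {false} {false} f g = refl
T-ext {false} {true}  f g = ⊥-elim (g _)
T-ext {true}  {false} f g = ⊥-elim (f _)
T-ext {true}  {true}  f g = refl

∈-tabulate : ∀ {n} (f : Fin n → Bool) {x} → x ∈ tabulate f ⇔ T (f x)
∈-tabulate f {x} = mk⇔
  (λ x∈ → from T-≡ (trans (sym (lookup∘tabulate f x)) ([]=⇒lookup x∈)))
  (λ t  → lookup⇒[]= x _ (trans (lookup∘tabulate f x) (to T-≡ t)))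

∈-minus⁻ : ∀ {n} {p : Subset n} {x y} → x ∈ p - y → x ∈ p × x ≢ y
∈-minus⁻ {p = p} x∈ = p─q⊆p p _ x∈ , ≢ p x∈
  where
  ≢ : ∀ {n} (p : Subset n) {x y} → x ∈ p - y → x ≢ y
  ≢ (_ ∷ p) {zero}  {suc y} _ ()
  ≢ (_ ∷ p) {suc x} {suc y} (there x∈) refl = ≢ p x∈ refl

∣-∣ : ∀ {n} {p : Subset n} {x} → x ∈ p → suc ∣ p - x ∣ ≡ ∣ p ∣
∣-∣ {p = inside ∷ p}  here       = cong (suc ∘ ∣_∣) (p─⊥≡p p)
∣-∣ {p = inside ∷ p}  (there x∈) = cong suc (∣-∣ x∈)
∣-∣ {p = outside ∷ p} (there x∈) = ∣-∣ x∈

infixl 6 _⊕_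
_⊕_ : ∀ {n} → Subset n → Fin n → Subset n
p ⊕ x = p ∪ ⁅ x ⁆

∈-⊕⁻ : ∀ {n} {p : Subset n} {x y} → x ∈ p ⊕ y → x ∈ p ⊎ x ≡ y
∈-⊕⁻ {p = p} x∈ with x∈p∪q⁻ p _ x∈
... | inj₁ x∈p = inj₁ x∈p
... | inj₂ x∈y = inj₂ (x∈⁅y⁆⇒x≡y _ x∈y)

∈-⊕ˡ : ∀ {n} {p : Subset n} {x y} → x ∈ p → x ∈ p ⊕ y
∈-⊕ˡ = p⊆p∪q _

∈-⊕ʳ : ∀ {n} {p : Subset n} {x} → x ∈ p ⊕ x
∈-⊕ʳ {p = p} {x} = q⊆p∪q p _ (x∈⁅x⁆ x)

∉-⊕ : ∀ {n} {p : Subset n} {x y} → x ∉ p → x ≢ y → x ∉ p ⊕ y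
∉-⊕ x∉ x≢ x∈ = [ x∉ , x≢ ]′ (∈-⊕⁻ x∈)

∣⊕∣ : ∀ {n} (p : Subset n) {x} → x ∉ p → ∣ p ⊕ x ∣ ≡ suc ∣ p ∣
∣⊕∣ (inside ∷ p)  {zero}  x∉ = contradiction here x∉
∣⊕∣ (outside ∷ p) {zero}  x∉ = cong (suc ∘ ∣_∣) (∪-identityʳ p)
∣⊕∣ (inside ∷ p)  {suc x} x∉ = cong suc (∣⊕∣ p (x∉ ∘ there))
∣⊕∣ (outside ∷ p) {suc x} x∉ = ∣⊕∣ p (x∉ ∘ there)

∣⊕∣≤ : ∀ {n} (p : Subset n) x → ∣ p ⊕ x ∣ ≤ suc ∣ p ∣
∣⊕∣≤ p x with x ∈? p
... | no  x∉ = ≤-reflexive (∣⊕∣ p x∉)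
... | yes x∈ = ≤-trans
  (p⊆q⇒∣p∣≤∣q∣ {p = p ⊕ x} {q = p} λ y∈ → [ id , (λ { refl → x∈ }) ]′ (∈-⊕⁻ y∈))
  (ℕₚ.n≤1+n _)

⊕-comm : ∀ {n} (p : Subset n) x y → p ⊕ x ⊕ y ≡ p ⊕ y ⊕ x
⊕-comm p x y = trans (∪-assoc p _ _) (trans (cong (p ∪_) (∪-comm ⁅ x ⁆ ⁅ y ⁆)) (sym (∪-assoc p _ _)))

∃∈∉ : ∀ {n} (p q : Subset n) → ∣ q ∣ < ∣ p ∣ → ∃[ x ] (x ∈ p × x ∉ q)
∃∈∉ p q q<p with any? (λ x → (x ∈? p) ×-dec ¬? (x ∈? q))
... | yes w = w
... | no ¬w = contradiction (p⊆q⇒∣p∣≤∣q∣ p⊆q) (ℕₚ.<⇒≱ q<p)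
  where
  p⊆q : p ⊆ q
  p⊆q {x} x∈ = decidable-stable (x ∈? q) λ x∉ → ¬w (x , x∈ , x∉)

record Enumeration {n} (p : Subset n) (m : ℕ) : Set where
  field
    elem      : Fin m → Fin n
    injective : Injective _≡_ _≡_ elem
    elem∈     : ∀ i → elem i ∈ p
    covers    : ∀ {x} → x ∈ p → ∃[ i ] elem i ≡ x

enumerate : ∀ {n} (p : Subset n) → Enumeration p ∣ p ∣
enumerate [] = record
  { elem = λ () ; injective = λ { {()} } ; elem∈ = λ () ; covers = λ () }
enumerate (outside ∷ p) = record
  { elem      = suc ∘ elem
  ; injective = injective ∘ Finₚ.suc-injective
  ; elem∈     = λ i → there (elem∈ i)
  ; covers    = λ { (there x∈) → let i , eq = covers x∈ in i , cong suc eq }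
  }
  where open Enumeration (enumerate p)
enumerate {suc n} (inside ∷ p) = record
  { elem      = elem′
  ; injective = λ {i} {j} → inj i j
  ; elem∈     = λ { zero → here ; (suc i) → there (elem∈ i) }
  ; covers    = λ { here → zero , refl ; (there x∈) → let i , eq = covers x∈ in suc i , cong suc eq }
  }
  where
  open Enumeration (enumerate p)
  elem′ : Fin (suc ∣ p ∣) → Fin (suc n)
  elem′ zero    = zero
  elem′ (suc i) = suc (elem i)
  inj : ∀ i j → elem′ i ≡ elem′ j → i ≡ j
  inj zero    zero    _  = refl
  inj (suc i) (suc j) eq = cong suc (injective (Finₚ.suc-injective eq))

-- Used to refute a fourth neighbour in a cubic graph.
distinct≤∣p∣ : ∀ {n} {p : Subset n} {a b c d} → a ∈ p → b ∈ p → c ∈ p → d ∈ p →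
               a ≢ b → a ≢ c → a ≢ d → b ≢ c → b ≢ d → c ≢ d → 4 ≤ ∣ p ∣
distinct≤∣p∣ {p = p} {a} {b} {c} {d} a∈ b∈ c∈ d∈ a≢b a≢c a≢d b≢c b≢d c≢d =
  subst (4 ≤_) (∣-∣ d∈) (s≤s
    (subst (3 ≤_) (∣-∣ (x∈p∧x≢y⇒x∈p-y c∈ c≢d)) (s≤s
      (subst (2 ≤_) (∣-∣ (x∈p∧x≢y⇒x∈p-y (x∈p∧x≢y⇒x∈p-y b∈ b≢d) b≢c)) (s≤s
        (subst (1 ≤_) (∣-∣ (x∈p∧x≢y⇒x∈p-y (x∈p∧x≢y⇒x∈p-y (x∈p∧x≢y⇒x∈p-y a∈ a≢d) a≢c) a≢b))
          (s≤s z≤n)))))))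

-- Containing a copy: decidability and monotonicity.

containsCopy? : ∀ G F → Dec (ContainsCopy G F)
containsCopy? G F = map′
  (λ (c , inj , hom) → finToFun c , (λ {x} {y} → inj x y) , hom)
  (λ (f , inj , hom) → let eq = finToFun-funToFin f in
     funToFin f
     , (λ x y e → inj (trans (sym (eq x)) (trans e (eq y))))
     , (λ x y a → subst₂ (Adj G) (sym (eq x)) (sym (eq y)) (hom x y a)))
  -- Maps between the two vertex sets are searched through their codes in a finite type.
  (any? λ c → let f = finToFun {order G} {order F} c in
     all? (λ x → all? λ y → (f x ≟ f y) →-dec (x ≟ y))
     ×-dec all? (λ x → all? λ y → T? (adj F x y) →-dec T? (adj G (f x) (f y))))

-- Completeness only refutes `¬ Super 𝒰 G`; this decision removes the double negation at the end.
super? : ∀ 𝒰 G → Dec (Super 𝒰 G)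
super? 𝒰 G = Any.any? (containsCopy? G) 𝒰

containsCopy-trans : ∀ {G H F} → ContainsCopy G H → ContainsCopy H F → ContainsCopy G F
containsCopy-trans (g , g-inj , g-hom) (f , f-inj , f-hom) =
  g ∘ f , f-inj ∘ g-inj , λ x y → g-hom (f x) (f y) ∘ f-hom x y

super-mono : ∀ {𝒰 G H} → ContainsCopy G H → Super 𝒰 H → Super 𝒰 G
super-mono {G = G} {H} H⊆G = Any.map λ {F} → containsCopy-trans {G} {H} {F} H⊆G

adj-sym : ∀ G {x y} → Adj G x y → Adj G y x
adj-sym G {x} {y} = subst T (symmetric G x y)

adj-irr : ∀ G {x} → ¬ Adj G x x
adj-irr G {x} = subst T (irreflexive G x)

-- Bags moving through a fixed graph.

_[_↦_] : ∀ {n} → Subset n → Fin n → Fin n → Subset n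
U [ u ↦ v ] = (U - u) ⊕ v

module Search (k : ℕ) (G : Graph) where

  private
    VSet = Subset (order G)

  ClosedAt : VSet → Vertex G → Set
  ClosedAt S x = ∀ y → Adj G x y → y ∈ S

  -- S is the set of vertices that have occurred in some bag, U the current bag.
  record IsFront (S U : VSet) : Set where
    field
      size     : ∣ U ∣ ≡ suc k
      within   : U ⊆ S
      boundary : ∀ x → x ∈ S → x ∉ U → ClosedAt S x

    boundary′ : ∀ {x y} → x ∈ S → y ∉ S → Adj G x y → x ∈ U
    boundary′ {x} {y} x∈S y∉S xy = decidable-stable (x ∈? U) λ x∉U → y∉S (boundary x x∈S x∉U y xy)

  -- The only vertex newly outside the bag is `u`, and its neighbours all lie in `S`. Being unseen,
  -- `v` is not in `U`, so the size is kept.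
  front-move : ∀ {S U u v} → IsFront S U → u ∈ U → ClosedAt S u → v ∉ S →
               IsFront (S ⊕ v) (U [ u ↦ v ])
  front-move {S} {U} {u} {v} front u∈U closed v∉S = record
    { size     = trans (∣⊕∣ (U - u) (λ v∈ → v∉S (within (proj₁ (∈-minus⁻ v∈))))) (trans (∣-∣ u∈U) size)
    ; within   = λ x∈ → [ ∈-⊕ˡ ∘ within ∘ proj₁ ∘ ∈-minus⁻ , (λ { refl → ∈-⊕ʳ }) ]′ (∈-⊕⁻ x∈)
    ; boundary = bd
    }
    where
    open IsFront front
    bd : ∀ x → x ∈ S ⊕ v → x ∉ U [ u ↦ v ] → ClosedAt (S ⊕ v) x
    bd x x∈ x∉ y xy with ∈-⊕⁻ x∈
    ... | inj₂ refl = contradiction ∈-⊕ʳ x∉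
    ... | inj₁ x∈S with x ≟ u
    ...   | yes refl = ∈-⊕ˡ (closed y xy)
    ...   | no x≢u   = ∈-⊕ˡ (boundary x x∈S (λ x∈U → x∉ (∈-⊕ˡ (x∈p∧x≢y⇒x∈p-y x∈U x≢u))) y xy)

  -- A seen neighbour of an unseen vertex lies in `U`, and it is not `u`, whose neighbours have all
  -- been seen. Hence every edge from `S` to `v` lies inside the new bag, and `v` is isolated in the
  -- associated graph.
  front-stays : ∀ {S U u v z} → IsFront S U → ClosedAt S u → v ∉ S →
                z ∈ S → Adj G z v → z ∈ U [ u ↦ v ]
  front-stays front c v∉ z∈S zv =
    ∈-⊕ˡ (x∈p∧x≢y⇒x∈p-y (IsFront.boundary′ front z∈S v∉ zv) λ { refl → v∉ (c _ zv) })

  -- The moves made so far, growing at the end, so that the last one can be inspected and replaced.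
  -- At the start nothing has been seen outside the first bag.
  data Past : VSet → VSet → Set where
    start : ∀ {U} → ∣ U ∣ ≡ suc k → Past U U
    move  : ∀ {S U} → Past S U → ∀ u v → u ∈ U → ClosedAt S u → v ∉ S →
            Past (S ⊕ v) (U [ u ↦ v ])

  past⇒front : ∀ {S U} → Past S U → IsFront S U
  past⇒front (start size) = record
    { size = size ; within = id ; boundary = λ x x∈ x∉ → contradiction x∈ x∉ }
  past⇒front (move past u v u∈U closed v∉S) = front-move (past⇒front past) u∈U closed v∉S

  -- The moves still to come, until every vertex has been seen. It grows at the front, so that its
  -- bags are listed by recursion from the current one on.
  data Run : VSet → VSet → Set where
    stop : ∀ {S U} → (∀ x → x ∈ S) → Run S U
    move : ∀ {S U} u v → u ∈ U → ClosedAt S u → v ∉ S →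
           Run (S ⊕ v) (U [ u ↦ v ]) → Run S U

  steps : ∀ {S U} → Run S U → ℕ
  steps (stop _)           = 0
  steps (move _ _ _ _ _ r) = suc (steps r)

  bags : ∀ {S U} (r : Run S U) → Fin (suc (steps r)) → VSet
  bags {U = U} r          zero    = U
  bags (move _ _ _ _ _ r) (suc i) = bags r i

  bag-size : ∀ {S U} (r : Run S U) → IsFront S U → ∀ i → ∣ bags r i ∣ ≡ suc k
  bag-size r                   front zero    = IsFront.size front
  bag-size (move u v u∈ c v∉ r) front (suc i) = bag-size r (front-move front u∈ c v∉) i

  consecutive-bags : ∀ {S U} (r : Run S U) → IsFront S U → ∀ i j → toℕ j ≡ suc (toℕ i) →
                     ∣ bags r i ∩ bags r j ∣ ≡ k
  consecutive-bags {S} {U} (move u v u∈ c v∉ r) front zero (suc zero) _ =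
    trans (cong ∣_∣ (⊆-antisym ∩⊆ ⊆∩)) (suc-injective (trans (∣-∣ u∈) size))
    where
    open IsFront front
    ∩⊆ : U ∩ U [ u ↦ v ] ⊆ U - u
    ∩⊆ x∈ with x∈p∩q⁻ U _ x∈
    ... | x∈U , x∈′ = [ id , (λ { refl → contradiction (within x∈U) v∉ }) ]′ (∈-⊕⁻ x∈′)
    ⊆∩ : U - u ⊆ U ∩ U [ u ↦ v ]
    ⊆∩ x∈ = x∈p∩q⁺ (proj₁ (∈-minus⁻ x∈) , ∈-⊕ˡ x∈)
  consecutive-bags (move u v u∈ c v∉ r) front (suc i) (suc j) eq =
    consecutive-bags r (front-move front u∈ c v∉) i j (suc-injective eq)

  -- A run shows only the current bag and what enters later; vertices of `S` may have left before,
  -- hence the first alternative. If the run starts with `S` equal to `U`, that alternative means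
  -- the first bag.
  bags-cover : ∀ {S U} (r : Run S U) x → x ∈ S ⊎ ∃[ i ] x ∈ bags r i
  bags-cover (stop all)          x = inj₁ (all x)
  bags-cover (move u v u∈ c v∉ r) x with bags-cover r x
  ... | inj₂ (i , x∈) = inj₂ (suc i , x∈)
  ... | inj₁ x∈ with ∈-⊕⁻ x∈
  ...   | inj₁ x∈S  = inj₁ x∈S
  ...   | inj₂ refl = inj₂ (suc zero , ∈-⊕ʳ)

  -- An edge is covered when its later end enters: by `front-stays` the earlier end is still in the
  -- bag.
  bags-cover-edges : ∀ {S U} (r : Run S U) → IsFront S U → ∀ x y → Adj G x y →
                     (x ∈ S × y ∈ S) ⊎ ∃[ i ] (x ∈ bags r i × y ∈ bags r i)
  bags-cover-edges (stop all) _ x y _ = inj₁ (all x , all y)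
  bags-cover-edges {S} {U} (move u v u∈ c v∉ r) front x y xy
    with bags-cover-edges r (front-move front u∈ c v∉) x y xy
  ... | inj₂ (i , x∈ , y∈) = inj₂ (suc i , x∈ , y∈)
  ... | inj₁ (x∈ , y∈) with ∈-⊕⁻ x∈ | ∈-⊕⁻ y∈
  ...   | inj₁ x∈S  | inj₁ y∈S  = inj₁ (x∈S , y∈S)
  ...   | inj₂ refl | inj₂ refl = ⊥-elim (adj-irr G xy)
  ...   | inj₁ x∈S  | inj₂ refl = inj₂ (suc zero , front-stays front c v∉ x∈S xy , ∈-⊕ʳ)
  ...   | inj₂ refl | inj₁ y∈S  = inj₂ (suc zero , ∈-⊕ʳ , front-stays front c v∉ y∈S (adj-sym G xy))

  -- Only unseen vertices enter, so a vertex that has left stays away. The interval property rests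
  -- on this.
  no-return : ∀ {S U} (r : Run S U) i {x} → x ∈ S → x ∈ bags r i → x ∈ U
  no-return r zero x∈S x∈ = x∈
  no-return (move u v u∈ c v∉ r) (suc i) x∈S x∈ with ∈-⊕⁻ (no-return r i (∈-⊕ˡ x∈S) x∈)
  ... | inj₁ x∈U- = proj₁ (∈-minus⁻ x∈U-)
  ... | inj₂ refl = contradiction x∈S v∉

  bags-interval : ∀ {S U} (r : Run S U) → IsFront S U → ∀ x i j l → i Fin.≤ j → j Fin.≤ l →
                  x ∈ bags r i → x ∈ bags r l → x ∈ bags r j
  bags-interval r front x zero zero l _ _ x∈i _ = x∈i
  bags-interval (move u v u∈ c v∉ r) front x zero (suc j) (suc l) _ (s≤s j≤l) x∈i x∈l =
    bags-interval r front′ x zero j l z≤n j≤l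
      (no-return r l (∈-⊕ˡ (IsFront.within front x∈i)) x∈l) x∈l
    where front′ = front-move front u∈ c v∉
  bags-interval (move u v u∈ c v∉ r) front x (suc i) (suc j) (suc l) (s≤s i≤j) (s≤s j≤l) =
    bags-interval r (front-move front u∈ c v∉) x i j l i≤j j≤l

  -- Positions within a run, and the smooth decomposition that a run yields.

  data Stage : ∀ {S U S′ U′} → Run S U → Run S′ U′ → Set where
    now   : ∀ {S U} {r : Run S U} → Stage r r
    later : ∀ {S U S′ U′ u v u∈ c v∉} {r : Run (S ⊕ v) (U [ u ↦ v ])} {r′ : Run S′ U′} →
            Stage r r′ → Stage (move {S} {U} u v u∈ c v∉ r) r′

  next-stage : ∀ {S₀ U₀ S U u v u∈ c v∉} {r₀ : Run S₀ U₀} {r : Run (S ⊕ v) (U [ u ↦ v ])} →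
               Stage r₀ (move {S} {U} u v u∈ c v∉ r) → Stage r₀ r
  next-stage now       = later now
  next-stage (later s) = later (next-stage s)

  index : ∀ {S U S′ U′} {r : Run S U} {r′ : Run S′ U′} → Stage r r′ → Fin (suc (steps r))
  index now       = zero
  index (later s) = suc (index s)

  bag-index : ∀ {S U S′ U′} {r : Run S U} {r′ : Run S′ U′} (s : Stage r r′) → bags r (index s) ≡ U′
  bag-index now       = refl
  bag-index (later s) = bag-index s

  -- Identifies the seen set with the vertex set of the associated graph once the whole run starts
  -- at its first bag. The alternative `x ∈ S` makes the induction over later starting points
  -- possible.
  seen⇔ : ∀ {S U S′ U′} {r : Run S U} {r′ : Run S′ U′} → IsFront S U → (s : Stage r r′) → ∀ x →
          x ∈ S′ ⇔ (x ∈ S ⊎ ∃[ j ] (j Fin.≤ index s × x ∈ bags r j))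
  seen⇔ front now x = mk⇔ inj₁ λ
    { (inj₁ x∈) → x∈
    ; (inj₂ (zero , _ , x∈)) → IsFront.within front x∈ }
  seen⇔ {S} {S′ = S′} front (later {u = u} {v} {u∈} {c} {v∉} {r} s) x = mk⇔ ⇒ ⇐
    where
    ih = seen⇔ (front-move front u∈ c v∉) s x
    ⇒ : x ∈ S′ → x ∈ S ⊎ ∃[ j ] (j Fin.≤ suc (index s) × x ∈ bags (move u v u∈ c v∉ r) j)
    ⇒ x∈ with to ih x∈
    ... | inj₂ (j , j≤ , x∈j) = inj₂ (suc j , s≤s j≤ , x∈j)
    ... | inj₁ x∈ with ∈-⊕⁻ x∈
    ...   | inj₁ x∈S  = inj₁ x∈S
    ...   | inj₂ refl = inj₂ (suc zero , s≤s z≤n , ∈-⊕ʳ)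
    ⇐ : x ∈ S ⊎ ∃[ j ] (j Fin.≤ suc (index s) × x ∈ bags (move u v u∈ c v∉ r) j) → x ∈ S′
    ⇐ (inj₁ x∈S)                    = from ih (inj₁ (∈-⊕ˡ x∈S))
    ⇐ (inj₂ (zero , _ , x∈))        = from ih (inj₁ (∈-⊕ˡ (IsFront.within front x∈)))
    ⇐ (inj₂ (suc j , s≤s j≤ , x∈)) = from ih (inj₂ (j , j≤ , x∈))

  -- The moves of the past are put in front of the run, the last one first.
  rewind : ∀ {S U} → Past S U → (r : Run S U) →
           ∃[ U₀ ] (∣ U₀ ∣ ≡ suc k × Σ[ r₀ ∈ Run U₀ U₀ ] Stage r₀ r)
  rewind (start size) r = _ , size , r , now
  rewind (move past u v u∈ c v∉) r =
    let U₀ , size , r₀ , s = rewind past (move u v u∈ c v∉ r)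
    in U₀ , size , r₀ , next-stage s

  decomposition : ∀ {U} → ∣ U ∣ ≡ suc k → Run U U → PathDecomposition G
  decomposition {U} size r = record
    { length   = suc (steps r)
    ; bag      = bags r
    ; vertices = λ x → [ (zero ,_) , id ]′ (bags-cover r x)
    ; edges    = λ x y xy → [ (zero ,_) , id ]′ (bags-cover-edges r front x y xy)
    ; interval = bags-interval r front
    }
    where
    front : IsFront U U
    front = past⇒front (start size)

  max-const : ∀ m (f : Fin (suc m) → ℕ) c → (∀ i → f i ≡ c) → foldr _⊔_ 0 f ≡ c
  max-const zero    f c eq = trans (ℕₚ.⊔-identityʳ (f zero)) (eq zero)
  max-const (suc m) f c eq =
    trans (cong₂ _⊔_ (eq zero) (max-const m (f ∘ suc) c (eq ∘ suc))) (ℕₚ.⊔-idem c)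

  decomposition-smooth : ∀ {U} (size : ∣ U ∣ ≡ suc k) (r : Run U U) → IsSmooth k (decomposition size r)
  decomposition-smooth {U} size r = record
    { width≡   = cong (_∸ 1) (max-const _ _ (suc k) sizes)
    ; bagSize  = sizes
    ; adjacent = consecutive-bags r front
    }
    where
    front : IsFront U U
    front = past⇒front (start size)
    sizes = bag-size r front

  -- Vertex orders with small separators.

  Separated : VSet → Set
  Separated S = ∃[ B ] (∣ B ∣ ≤ k × (∀ x y → x ∈ S → y ∉ S → Adj G x y → x ∈ B))

  -- The future as a mere order of the unseen vertices. No departing vertices are chosen yet, so the
  -- order can be rearranged before `run` picks them.
  data Layout (S : VSet) : Set where
    full : (∀ x → x ∈ S) → Layout S
    add  : ∀ v → Separated S → v ∉ S → Layout (S ⊕ v) → Layout S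

  -- Pigeonhole: the bag has `k + 1` vertices and the separator at most `k`, and a vertex of the bag
  -- outside the separator has no unseen neighbour.
  removable : ∀ {S U} → IsFront S U → Separated S → ∃[ u ] (u ∈ U × ClosedAt S u)
  removable {S} {U} front (B , ∣B∣≤k , sep) =
    let u , u∈U , u∉B = ∃∈∉ U B (subst (∣ B ∣ <_) (sym size) (s≤s ∣B∣≤k))
    in u , u∈U , λ y uy → decidable-stable (y ∈? S) λ y∉S → u∉B (sep u y (within u∈U) y∉S uy)
    where open IsFront front

  run : ∀ {S U} → IsFront S U → Layout S → Run S U
  run front (full all) = stop all
  run front (add v sep v∉ layout) =
    let u , u∈ , c = removable front sep
    in move u v u∈ c v∉ (run (front-move front u∈ c v∉) layout)

  -- While `w` is still to come in the old order, `a` has it as an unseen neighbour and so lies in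
  -- the separator. In the new order `a` has no unseen neighbour left, so `w` replaces `a` there
  -- without raising the size. From the old turn of `w` on, both orders agree.
  layout-insert : ∀ {S a w} → a ∈ S → w ∉ S → Adj G a w → ClosedAt (S ⊕ w) a →
                  Layout S → Layout (S ⊕ w)
  layout-insert a∈ w∉ aw closed (full all) = contradiction (all _) w∉
  layout-insert {S} {a} {w} a∈ w∉ aw closed (add v (B , ∣B∣≤k , sep) v∉ layout) with w ≟ v
  ... | yes refl = layout
  ... | no w≢v   =
    add v (B [ a ↦ w ] , size , sep′) (∉-⊕ v∉ (w≢v ∘ sym))
      (subst Layout (⊕-comm S v w)
        (layout-insert (∈-⊕ˡ a∈) (∉-⊕ w∉ w≢v) aw
          (λ y ay → subst (y ∈_) (⊕-comm S w v) (∈-⊕ˡ (closed y ay))) layout))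
    where
    size : ∣ B [ a ↦ w ] ∣ ≤ k
    size = ≤-trans (∣⊕∣≤ (B - a) w) (≤-trans (≤-reflexive (∣-∣ (sep a w a∈ w∉ aw))) ∣B∣≤k)
    sep′ : ∀ x y → x ∈ S ⊕ w → y ∉ S ⊕ w → Adj G x y → x ∈ B [ a ↦ w ]
    sep′ x y x∈ y∉ xy with ∈-⊕⁻ x∈
    ... | inj₂ refl = ∈-⊕ʳ
    ... | inj₁ x∈S  = ∈-⊕ˡ (x∈p∧x≢y⇒x∈p-y (sep x y x∈S (y∉ ∘ ∈-⊕ˡ) xy)
                             λ { refl → y∉ (closed y xy) })

-- Least indices, isomorphisms of pairs, and the edges of an extended graph.

least : ∀ {m} {P : Fin m → Set} → Decidable P → ∃ P → ∃[ i ] (P i × (∀ j → P j → i Fin.≤ j))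
least {suc m} P? (x , px) with P? zero
... | yes p₀ = zero , p₀ , λ _ _ → z≤n
least {suc m} P? (zero , p₀)  | no ¬p₀ = contradiction p₀ ¬p₀
least {suc m} P? (suc x , px) | no ¬p₀ =
  let i , pi , min = least (P? ∘ suc) (x , px)
  in suc i , pi , λ { zero p₀ → contradiction p₀ ¬p₀ ; (suc j) pj → s≤s (min j pj) }

⟨$⟩ʳ-injective : ∀ {m n} (φ : Perm.Permutation m n) → Injective _≡_ _≡_ (φ ⟨$⟩ʳ_)
⟨$⟩ʳ-injective φ eq = trans (sym (inverseˡ φ)) (trans (cong (φ ⟨$⟩ˡ_) eq) (inverseˡ φ))

≅ₚ-sym : ∀ {P P′} → P ≅ₚ P′ → P′ ≅ₚ P
≅ₚ-sym {P} {P′} (φ , iso) = Perm.flip φ , record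
  { graphIso = λ x y → trans (sym (graphIso (φ ⟨$⟩ˡ x) (φ ⟨$⟩ˡ y)))
                             (cong₂ (adj (graph P′)) (inverseʳ φ) (inverseʳ φ))
  ; partIso  = λ x → mk⇔
      (λ x∈ → from (partIso (φ ⟨$⟩ˡ x)) (subst (_∈ part P′) (sym (inverseʳ φ)) x∈))
      (λ x∈ → subst (_∈ part P′) (inverseʳ φ) (to (partIso (φ ⟨$⟩ˡ x)) x∈))
  }
  where open IsPairIso iso

addVertex-adj : ∀ H u Y u∉Y {x y} → Adj (addVertex H u Y u∉Y) (suc x) (suc y) ⇔
                (Adj H x y ⊎ (x ≡ u × y ∈ Y) ⊎ (y ≡ u × x ∈ Y))
addVertex-adj H u Y u∉Y {x} {y} = mk⇔
  (λ t → [ inj₁ , (λ t → inj₂ ([ inj₁ ∘ new⁻ , inj₂ ∘ new⁻ ]′ (to T-∨ t))) ]′ (to T-∨ t))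
  (λ s → from (T-∨ {adj H x y})
    ([ inj₁ , (λ s → inj₂ (from T-∨ ([ inj₁ ∘ new⁺ , inj₂ ∘ new⁺ ]′ s))) ]′ s))
  where
  new⁻ : ∀ {x y} → T (⌊ x ≟ u ⌋ ∧ ⌊ y ∈? Y ⌋) → x ≡ u × y ∈ Y
  new⁻ {x} {y} t = let a , b = to (T-∧ {⌊ x ≟ u ⌋}) t in toWitness a , toWitness {a? = y ∈? Y} b
  new⁺ : ∀ {x y} → x ≡ u × y ∈ Y → T (⌊ x ≟ u ⌋ ∧ ⌊ y ∈? Y ⌋)
  new⁺ {x} (x≡u , y∈Y) = from (T-∧ {⌊ x ≟ u ⌋}) (fromWitness x≡u , fromWitness y∈Y)

act-fixed : ∀ {P} (φ : Aut P) {u x} → act φ u ≡ u → act φ x ≡ u → x ≡ u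
act-fixed (φ , _) φu φx = ⟨$⟩ʳ-injective φ (trans φx (sym φu))

-- The automorphism is continued by fixing the new vertex; as it fixes `u`, it carries the edges
-- from `u` to `Y` onto those from `u` to `Z`. This justifies discarding the images of a processed
-- `Y`.
extend-≅ : ∀ {P u Y Z} u∉Y u∉Z (φ : Aut P) → act φ u ≡ u →
           (∀ x → x ∈ Y ⇔ act φ x ∈ Z) → extend P u Y u∉Y ≅ₚ extend P u Z u∉Z
extend-≅ {P} {u} {Y} {Z} u∉Y u∉Z φ φu image = Perm.lift₀ (proj₁ φ) , record
  { graphIso = λ
      { zero zero → refl ; zero (suc y) → refl ; (suc x) zero → refl
      ; (suc x) (suc y) → T-ext
          (λ t → from Y-adj ([ inj₁ ∘ subst T (graphIso x y)
                             , (λ s → inj₂ ([ inj₁ ∘ back , inj₂ ∘ back ]′ s)) ]′ (to Z-adj t)))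
          (λ t → from Z-adj ([ inj₁ ∘ subst T (sym (graphIso x y))
                             , (λ s → inj₂ ([ inj₁ ∘ forth , inj₂ ∘ forth ]′ s)) ]′ (to Y-adj t))) }
  ; partIso  = λ
      { zero → mk⇔ (λ _ → here) (λ _ → here)
      ; (suc x) → mk⇔
          (λ { (there x∈) → let x∈U , x≢u = ∈-minus⁻ x∈ in
                 there (x∈p∧x≢y⇒x∈p-y (to (partIso x) x∈U) (x≢u ∘ act-fixed φ φu)) })
          (λ { (there x∈) → let x∈U , x≢u = ∈-minus⁻ x∈ in
                 there (x∈p∧x≢y⇒x∈p-y (from (partIso x) x∈U) λ { refl → x≢u φu }) }) }
  }
  where
  open IsPairIso (proj₂ φ)
  Y-adj : ∀ {x y} → _
  Y-adj {x} {y} = addVertex-adj (graph P) u Y u∉Y {x} {y}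
  Z-adj : ∀ {x y} → _
  Z-adj {x} {y} = addVertex-adj (graph P) u Z u∉Z {x} {y}
  forth : ∀ {x y} → x ≡ u × y ∈ Y → act φ x ≡ u × act φ y ∈ Z
  forth (refl , y∈) = φu , to (image _) y∈
  back : ∀ {x y} → act φ x ≡ u × act φ y ∈ Z → x ≡ u × y ∈ Y
  back (φx , y∈) = act-fixed φ φu φx , from (image _) y∈

-- Copies of pairs inside a fixed graph.

module Copies (k : ℕ) (G : Graph) where

  open Search k G

  private
    VSet = Subset (order G)

  -- The graph of P is G[S] − E(G[U]), up to the names of the vertices.
  record Copy (P : Pair) (S U : VSet) : Set where
    field
      name      : Vertex (graph P) → Vertex G
      injective : Injective _≡_ _≡_ name
      onto      : ∀ y → y ∈ S ⇔ (∃[ x ] name x ≡ y)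
      part⇔     : ∀ x → x ∈ part P ⇔ name x ∈ U
      adj⇔      : ∀ x y → Adj (graph P) x y ⇔
                    (Adj G (name x) (name y) × ¬ (name x ∈ U × name y ∈ U))

    name∈ : ∀ x → name x ∈ S
    name∈ x = from (onto _) (x , refl)

  copy⇒subgraph : ∀ {P S U} → Copy P S U → ContainsCopy G (graph P)
  copy⇒subgraph c = name , injective , λ x y → proj₁ ∘ to (adj⇔ x y)
    where open Copy c

  -- The layout is completed to a run, the past is put in front of it, and the pair sits at the
  -- position where they meet. This yields the containment test for appending to the queue.
  copy⇒containsPair : ∀ {P S U} → Past S U → Layout S → Copy P S U → ContainsPair k G P
  copy⇒containsPair {P} {S} {U} past layout c
    with rewind past (run (past⇒front past) layout)
  ... | U₀ , size , r₀ , stage =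
    decomposition size r₀ , decomposition-smooth size r₀ , index stage , record
      { name      = name
      ; injective = injective
      ; onto      = λ y → mk⇔ (to (seen y) ∘ from (onto y)) (to (onto y) ∘ from (seen y))
      ; part⇔     = λ x → subst (λ V → x ∈ part P ⇔ name x ∈ V) (sym (bag-index stage)) (part⇔ x)
      ; adj⇔      = λ x y → subst (λ V → Adj (graph P) x y ⇔
                        (Seen (name x) × Seen (name y) × Adj G (name x) (name y) ×
                         ¬ (name x ∈ V × name y ∈ V))) (sym (bag-index stage))
                      (mk⇔ (λ t → to (seen _) (name∈ x) , to (seen _) (name∈ y) , to (adj⇔ x y) t)
                           (λ (_ , _ , s) → from (adj⇔ x y) s))
      }
    where
    open Copy c
    Seen : Vertex G → Set
    Seen = AssociatedVertex (decomposition size r₀) (index stage)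
    seen : ∀ y → y ∈ S ⇔ Seen y
    seen y = let s = seen⇔ (past⇒front (start size)) stage y in mk⇔
      (λ y∈ → [ (λ y∈U₀ → zero , z≤n , y∈U₀) , id ]′ (to s y∈)) (from s ∘ inj₂)

  copy-pull : ∀ {P P′ S U} → P′ ≅ₚ P → Copy P S U → Copy P′ S U
  copy-pull {P} (φ , iso) c = record
    { name      = λ x → name (φ ⟨$⟩ʳ x)
    ; injective = ⟨$⟩ʳ-injective φ ∘ injective
    ; onto      = λ y → mk⇔
        (λ y∈ → let x , eq = to (onto y) y∈ in φ ⟨$⟩ˡ x , trans (cong name (inverseʳ φ)) eq)
        (λ (x , eq) → from (onto y) (φ ⟨$⟩ʳ x , eq))
    ; part⇔     = λ x → mk⇔ (to (part⇔ _) ∘ to (partIso x)) (from (partIso x) ∘ from (part⇔ _))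
    ; adj⇔      = λ x y → mk⇔ (to (adj⇔ _ _) ∘ subst T (sym (graphIso x y)))
                              (subst T (graphIso x y) ∘ from (adj⇔ _ _))
    }
    where
    open Copy c
    open IsPairIso iso

  copy-initial : ∀ {U} → ∣ U ∣ ≡ suc k → Copy (initialPair k) U U
  copy-initial {U} size = record
    { name      = elem
    ; injective = injective
    ; onto      = λ y → mk⇔ covers λ { (x , refl) → elem∈ x }
    ; part⇔     = λ x → mk⇔ (λ _ → elem∈ x) (λ _ → ∈⊤)
    ; adj⇔      = λ x y → mk⇔ (λ ()) λ (_ , ¬inside) → ¬inside (elem∈ x , elem∈ y)
    }
    where open Enumeration (subst (Enumeration U) size (enumerate U))

  Extension : (P : Pair) → Vertex (graph P) → (Pair → Set) → Set
  Extension P u Q = ∃[ Y ] (Y ⊆ (part P - u) × Σ[ u∉Y ∈ u ∉ Y ] Q (extend P u Y u∉Y))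

  -- When `u` leaves, exactly the edges between `u` and the rest of the bag become edges of the
  -- associated graph, so `Y` consists of the neighbours of `u` in the bag. All edges at `v` lie
  -- inside the new bag and contribute nothing.
  copy-extend : ∀ {P S U} → IsFront S U → (c : Copy P S U) → ∀ {u v} → u ∈ part P →
                ClosedAt S (Copy.name c u) → v ∉ S →
                Extension P u (λ P′ → Copy P′ (S ⊕ v) (U [ Copy.name c u ↦ v ]))
  copy-extend {P} {S} {U} front c {u} {v} u∈ closed v∉ =
    Y , (λ {x} → proj₁ ∘ Y⁻ {x}) , u∉Y , record
      { name      = name′
      ; injective = λ {x} {y} → inj x y
      ; onto      = λ y → mk⇔ (onto⁺ y) (λ { (zero , refl) → ∈-⊕ʳ ; (suc x , refl) → ∈-⊕ˡ (name∈ x) })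
      ; part⇔     = λ
          { zero → mk⇔ (λ _ → ∈-⊕ʳ) (λ _ → here)
          ; (suc x) → mk⇔ (λ { (there x∈) → part⁺ x∈ }) (λ x∈ → there (part⁻ x∈)) }
      ; adj⇔      = λ
          { zero zero → mk⇔ (λ ()) λ (vv , _) → ⊥-elim (adj-irr G vv)
          ; zero (suc y) → mk⇔ (λ ()) λ (vy , ¬in) →
              ⊥-elim (¬in (∈-⊕ʳ , front-stays front closed v∉ (name∈ y) (adj-sym G vy)))
          ; (suc x) zero → mk⇔ (λ ()) λ (xv , ¬in) →
              ⊥-elim (¬in (front-stays front closed v∉ (name∈ x) xv , ∈-⊕ʳ))
          ; (suc x) (suc y) → mk⇔ (adj⁺ x y ∘ to (addVertex-adj (graph P) u Y u∉Y))
                                  (from (addVertex-adj (graph P) u Y u∉Y) ∘ adj⁻ x y) }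
      }
    where
    open Copy c
    open IsFront front
    U′ = U [ name u ↦ v ]
    isY : Vertex (graph P) → Bool
    isY x = ⌊ x ∈? (part P - u) ⌋ ∧ adj G (name u) (name x)
    Y = tabulate isY
    Y⁻ : ∀ {x} → x ∈ Y → x ∈ part P - u × Adj G (name u) (name x)
    Y⁻ {x} x∈ = let a , b = to (T-∧ {⌊ x ∈? (part P - u) ⌋}) (to (∈-tabulate isY) x∈)
                in toWitness {a? = x ∈? (part P - u)} a , b
    Y⁺ : ∀ {x} → x ∈ part P - u → Adj G (name u) (name x) → x ∈ Y
    Y⁺ {x} x∈ ux = from (∈-tabulate isY) (from (T-∧ {⌊ x ∈? (part P - u) ⌋}) (fromWitness x∈ , ux))
    u∉Y : u ∉ Y
    u∉Y = adj-irr G ∘ proj₂ ∘ Y⁻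
    name′ : Fin (suc (order (graph P))) → Vertex G
    name′ zero    = v
    name′ (suc x) = name x
    inj : ∀ x y → name′ x ≡ name′ y → x ≡ y
    inj zero    zero    _  = refl
    inj zero    (suc y) eq = contradiction (subst (_∈ S) (sym eq) (name∈ y)) v∉
    inj (suc x) zero    eq = contradiction (subst (_∈ S) eq (name∈ x)) v∉
    inj (suc x) (suc y) eq = cong suc (injective eq)
    onto⁺ : ∀ y → y ∈ S ⊕ v → ∃[ x ] name′ x ≡ y
    onto⁺ y y∈ with ∈-⊕⁻ y∈
    ... | inj₂ refl = zero , refl
    ... | inj₁ y∈S  = let x , eq = to (onto y) y∈S in suc x , eq
    part⁺ : ∀ {x} → x ∈ part P - u → name x ∈ U′
    part⁺ x∈ = let x∈U , x≢u = ∈-minus⁻ x∈ in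
      ∈-⊕ˡ (x∈p∧x≢y⇒x∈p-y (to (part⇔ _) x∈U) (x≢u ∘ injective))
    U′⁻ : ∀ {x} → name x ∈ U′ → name x ∈ U × name x ≢ name u
    U′⁻ {x} x∈ with ∈-⊕⁻ x∈
    ... | inj₁ x∈U- = ∈-minus⁻ x∈U-
    ... | inj₂ eq   = contradiction (subst (_∈ S) eq (name∈ x)) v∉
    part⁻ : ∀ {x} → name x ∈ U′ → x ∈ part P - u
    part⁻ x∈ = let x∈U , x≢u = U′⁻ x∈ in
      x∈p∧x≢y⇒x∈p-y (from (part⇔ _) x∈U) (x≢u ∘ cong name)
    adj⁺ : ∀ x y → Adj (graph P) x y ⊎ (x ≡ u × y ∈ Y) ⊎ (y ≡ u × x ∈ Y) →
           Adj G (name x) (name y) × ¬ (name x ∈ U′ × name y ∈ U′)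
    adj⁺ x y (inj₁ xy) = let a , ¬in = to (adj⇔ x y) xy in
      a , λ (x∈ , y∈) → ¬in (proj₁ (U′⁻ x∈) , proj₁ (U′⁻ y∈))
    adj⁺ x y (inj₂ (inj₁ (refl , y∈))) = proj₂ (Y⁻ y∈) , λ (u∈′ , _) → proj₂ (U′⁻ u∈′) refl
    adj⁺ x y (inj₂ (inj₂ (refl , x∈))) =
      adj-sym G (proj₂ (Y⁻ x∈)) , λ (_ , u∈′) → proj₂ (U′⁻ u∈′) refl
    adj⁻ : ∀ x y → Adj G (name x) (name y) × ¬ (name x ∈ U′ × name y ∈ U′) →
           Adj (graph P) x y ⊎ (x ≡ u × y ∈ Y) ⊎ (y ≡ u × x ∈ Y)
    -- An edge not inside the old bag was already in the graph of `P`. An edge inside the old bag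
    -- but not inside the new one must have the departing vertex as an end.
    adj⁻ x y (xy , ¬in) with name x ∈? U | name y ∈? U
    ... | no x∉  | _      = inj₁ (from (adj⇔ x y) (xy , x∉ ∘ proj₁))
    ... | yes _  | no y∉  = inj₁ (from (adj⇔ x y) (xy , y∉ ∘ proj₂))
    ... | yes x∈ | yes y∈ with x ≟ u | y ≟ u
    ...   | yes refl | yes refl = ⊥-elim (adj-irr G xy)
    ...   | yes refl | no y≢    = inj₂ (inj₁ (refl , Y⁺ (x∈p∧x≢y⇒x∈p-y (from (part⇔ y) y∈) y≢) xy))
    ...   | no x≢    | yes refl =
      inj₂ (inj₂ (refl , Y⁺ (x∈p∧x≢y⇒x∈p-y (from (part⇔ x) x∈) x≢) (adj-sym G xy)))
    ...   | no x≢    | no y≢    = ⊥-elim (¬in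
      ( part⁺ (x∈p∧x≢y⇒x∈p-y (from (part⇔ x) x∈) x≢)
      , part⁺ (x∈p∧x≢y⇒x∈p-y (from (part⇔ y) y∈) y≢)))

  -- For `v` and `w` outside `S`, the bijection that sends `v` to `w` and fixes `S`. It is given as
  -- a relation so that its inverse is the same relation with `v` and `w` exchanged.
  data Renamed (S : VSet) (v w : Vertex G) : Vertex G → Vertex G → Set where
    new : Renamed S v w v w
    old : ∀ {x} → x ∈ S → Renamed S v w x x

  rename : ∀ {S v} w x → x ∈ S ⊕ v → ∃ (Renamed S v w x)
  rename w x x∈ with ∈-⊕⁻ x∈
  ... | inj₁ x∈S  = x , old x∈S
  ... | inj₂ refl = w , new

  renamed-sym : ∀ {S v w x y} → Renamed S v w x y → Renamed S w v y x
  renamed-sym new      = new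
  renamed-sym (old x∈) = old x∈

  renamed-functional : ∀ {S v w x y z} → v ∉ S → Renamed S v w x y → Renamed S v w x z → y ≡ z
  renamed-functional v∉ new      new      = refl
  renamed-functional v∉ new      (old v∈) = contradiction v∈ v∉
  renamed-functional v∉ (old v∈) new      = contradiction v∈ v∉
  renamed-functional v∉ (old _)  (old _)  = refl

  renamed-old : ∀ {S v w x y} → Renamed S v w x y → x ≢ v → y ≡ x
  renamed-old new     x≢v = contradiction refl x≢v
  renamed-old (old _) _   = refl

  renamed-∈ : ∀ {S V u v w x y} → v ∉ S → Renamed S v w x y → x ∈ V [ u ↦ v ] → y ∈ V [ u ↦ w ]
  renamed-∈ v∉ new     x∈ = ∈-⊕ʳ
  renamed-∈ v∉ (old x∈S) x∈ with ∈-⊕⁻ x∈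
  ... | inj₁ x∈-  = ∈-⊕ˡ x∈-
  ... | inj₂ refl = contradiction x∈S v∉

  renamed-adj : ∀ {S U u v w x y x′ y′} → IsFront S U → ClosedAt S u → v ∉ S → w ∉ S →
                Renamed S v w x x′ → Renamed S v w y y′ →
                Adj G x y × ¬ (x ∈ U [ u ↦ v ] × y ∈ U [ u ↦ v ]) →
                Adj G x′ y′ × ¬ (x′ ∈ U [ u ↦ w ] × y′ ∈ U [ u ↦ w ])
  renamed-adj front c v∉ w∉ new       new       (xy , _)   = ⊥-elim (adj-irr G xy)
  renamed-adj front c v∉ w∉ new       (old y∈S) (xy , ¬in) =
    ⊥-elim (¬in (∈-⊕ʳ , front-stays front c v∉ y∈S (adj-sym G xy)))
  renamed-adj front c v∉ w∉ (old x∈S) new       (xy , ¬in) =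
    ⊥-elim (¬in (front-stays front c v∉ x∈S xy , ∈-⊕ʳ))
  renamed-adj front c v∉ w∉ (old x∈S) (old y∈S) (xy , ¬in) =
    xy , λ (x∈ , y∈) → ¬in (renamed-∈ w∉ (old x∈S) x∈ , renamed-∈ w∉ (old y∈S) y∈)

  -- The newest vertex of a bag is still isolated in the associated graph, so
  -- any other unseen vertex could have taken its place.
  copy-rename : ∀ {P S U u v w} → IsFront S U → ClosedAt S u → v ∉ S → w ∉ S →
                (c : Copy P (S ⊕ v) (U [ u ↦ v ])) →
                Σ[ c′ ∈ Copy P (S ⊕ w) (U [ u ↦ w ]) ]
                  ∀ x → Renamed S v w (Copy.name c x) (Copy.name c′ x)
  copy-rename {P} {S} {U} {u} {v} {w} front closed v∉ w∉ c = record
    { name      = name′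
    ; injective = λ {x} {y} eq → injective (renamed-functional w∉
                    (renamed-sym (subst (Renamed S v w (name x)) eq (renamed x)))
                    (renamed-sym (renamed y)))
    ; onto      = λ y → mk⇔ (onto⁺ y) λ { (x , refl) → onto⁻ (renamed x) }
    ; part⇔     = λ x → mk⇔ (renamed-∈ v∉ (renamed x) ∘ to (part⇔ x))
                            (from (part⇔ x) ∘ renamed-∈ w∉ (renamed-sym (renamed x)))
    ; adj⇔      = λ x y → mk⇔
        (renamed-adj front closed v∉ w∉ (renamed x) (renamed y) ∘ to (adj⇔ x y))
        (from (adj⇔ x y) ∘
          renamed-adj front closed w∉ v∉ (renamed-sym (renamed x)) (renamed-sym (renamed y)))
    } , renamed
    where
    open Copy c
    name′ : Vertex (graph P) → Vertex G
    name′ x = proj₁ (rename w (name x) (name∈ x))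
    renamed : ∀ x → Renamed S v w (name x) (name′ x)
    renamed x = proj₂ (rename w (name x) (name∈ x))
    onto⁻ : ∀ {x y} → Renamed S v w x y → y ∈ S ⊕ w
    onto⁻ new       = ∈-⊕ʳ
    onto⁻ (old x∈S) = ∈-⊕ˡ x∈S
    onto⁺ : ∀ y → y ∈ S ⊕ w → ∃[ x ] name′ x ≡ y
    onto⁺ y y∈ =
      let z , r  = rename {v = w} v y y∈
          x , eq = to (onto z) (seen r)
      in x , renamed-functional v∉ (subst (λ z → Renamed S v w z (name′ x)) eq (renamed x)) (renamed-sym r)
      where
      seen : ∀ {z} → Renamed S w v y z → z ∈ S ⊕ v
      seen new       = ∈-⊕ʳ
      seen (old y∈S) = ∈-⊕ˡ y∈S

  -- The invariant of completeness: the pair occurs at some moment of a search through `G` that can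
  -- still be finished.
  State : Pair → Set
  State P = ∃[ S ] ∃[ U ] (Past S U × Layout S × Copy P S U)

  state-extend : ∀ {P S U} → Past S U → (c : Copy P S U) → ∀ {u v} → u ∈ part P →
                 ClosedAt S (Copy.name c u) → v ∉ S → Layout (S ⊕ v) → Extension P u State
  state-extend past c u∈ closed v∉ layout =
    let Y , Y⊆ , u∉Y , c′ = copy-extend (past⇒front past) c u∈ closed v∉
    in Y , Y⊆ , u∉Y , _ , _ , move past _ _ (to (Copy.part⇔ c _) u∈) closed v∉ , layout , c′

  -- An edge of the associated graph is not inside the bag; as `u` is in the bag, its neighbours in
  -- that graph are seen vertices outside the bag.
  two-outside : ∀ {P S U} (c : Copy P S U) {u} → u ∈ part P → 2 ≤ degree (graph P) u →
                let a = Copy.name c u in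
                ∃[ x ] ∃[ y ] (x ≢ y × (x ∈ S × x ∉ U × Adj G a x) × (y ∈ S × y ∉ U × Adj G a y))
  two-outside {P} {S} {U} c {u} u∈ deg =
    let x , x∈ , _  = ∃∈∉ N ∅ (subst (_< ∣ N ∣) (sym (∣⊥∣≡0 (order (graph P)))) (≤-trans (s≤s z≤n) deg))
        y , y∈ , y∉ = ∃∈∉ N ⁅ x ⁆ (subst (_< ∣ N ∣) (sym (∣⁅x⁆∣≡1 x)) deg)
    in name x , name y , (λ eq → x∉⁅y⁆⇒x≢y y∉ (sym (injective eq))) , outside-U x∈ , outside-U y∈
    where
    open Copy c
    N = neighbours (graph P) u
    outside-U : ∀ {x} → x ∈ N → name x ∈ S × name x ∉ U × Adj G (name u) (name x)
    outside-U {x} x∈ = let ux , ¬in = to (adj⇔ u x) (to (∈-tabulate (adj (graph P) u)) x∈) in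
      name∈ x , (λ x∈U → ¬in (to (part⇔ u) u∈ , x∈U)) , ux

  -- Only w keeps the vertex a = name u in the bag. Let w enter in place of the
  -- newest vertex v: the pair stays the same, a can leave, and v enters next.
  postpone : ∀ {P S U} → Past S U → (c : Copy P S U) → ∀ {u x w} → u ∈ part P →
             let a = Copy.name c u in x ∈ S → x ∉ U → Adj G a x → w ∉ S → Adj G a w →
             (∀ z → Adj G a z → z ≢ w → z ∈ S × z ∉ U) → Layout S → Extension P u State
  -- In the first bag no seen vertex is outside the bag, so `x` rules this case out.
  postpone (start _) c u∈ x∈ x∉ ax w∉ aw others layout = contradiction x∈ x∉
  postpone {P} (move {S} {U} past b v b∈ closed v∉) c {u} {x} {w} u∈ x∈ x∉ ax w∉ aw others layout
    with copy-rename (past⇒front past) closed v∉ (w∉ ∘ ∈-⊕ˡ) c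
  ... | c′ , renamed =
    state-extend (move past b w b∈ closed (w∉ ∘ ∈-⊕ˡ)) c′ u∈
      (subst (ClosedAt (S ⊕ w)) (sym (renamed-old (renamed u) a≢v)) closed-a)
      (∉-⊕ v∉ λ { refl → w∉ ∈-⊕ʳ })
      (subst Layout (⊕-comm S v w) (layout-insert (Copy.name∈ c u) w∉ aw
        (λ z az → subst (z ∈_) (⊕-comm S w v) (∈-⊕ˡ (closed-a z az))) layout))
    where
    open IsFront (past⇒front past)
    a = Copy.name c u
    -- A vertex outside the present bag was complete before `v` entered: either it is `b`, which
    -- left then, or it was outside the previous bag already.
    before : ∀ {z} → z ∈ S ⊕ v → z ∉ U [ b ↦ v ] → z ∈ S × ClosedAt S z
    before {z} z∈ z∉ with ∈-⊕⁻ z∈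
    ... | inj₂ refl = contradiction ∈-⊕ʳ z∉
    ... | inj₁ z∈S with z ≟ b
    ...   | yes refl = z∈S , closed
    ...   | no z≢b   = z∈S , boundary z z∈S λ z∈U → z∉ (∈-⊕ˡ (x∈p∧x≢y⇒x∈p-y z∈U z≢b))
    a≢v : a ≢ v
    -- The neighbours of `x`, and `a` among them, were seen before `v`.
    a≢v a≡v = v∉ (subst (_∈ S) a≡v (proj₂ (before x∈ x∉) a (adj-sym G ax)))
    closed-a : ClosedAt (S ⊕ w) a
    closed-a z az with z ≟ w
    ... | yes refl = ∈-⊕ʳ
    ... | no z≢w   = let z∈ , z∉ = others z az z≢w in ∈-⊕ˡ (proj₁ (before z∈ z∉))

  -- If all neighbours of the prescribed vertex have been seen, it can leave at once. Otherwise it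
  -- has an unseen neighbour `w`, and its two neighbours in the associated graph leave no room for
  -- another, so `postpone` applies.
  state-extend-at : Cubic G → ∀ {P S U} → Past S U → Copy P S U → ∀ {u v} → u ∈ part P →
                    2 ≤ degree (graph P) u → Layout S → v ∉ S → Layout (S ⊕ v) → Extension P u State
  state-extend-at cubic {P} {S} {U} past c {u} {v} u∈ deg layout v∉ layout′
    with any? (λ w → T? (adj G (Copy.name c u) w) ×-dec ¬? (w ∈? S))
  ... | no none = state-extend past c u∈
        (λ y uy → decidable-stable (y ∈? S) λ y∉ → none (y , uy , y∉)) v∉ layout′
  ... | yes (w , aw , w∉) with two-outside c u∈ deg
  ...   | x , y , x≢y , (x∈S , x∉U , ax) , (y∈S , y∉U , ay) =
    postpone past c u∈ x∈S x∉U ax w∉ aw others layout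
    where
    a = Copy.name c u
    nb : ∀ {z} → Adj G a z → z ∈ neighbours G a
    nb = from (∈-tabulate (adj G a))
    others : ∀ z → Adj G a z → z ≢ w → z ∈ S × z ∉ U
    others z az z≢w with z ≟ x | z ≟ y
    ... | yes refl | _        = x∈S , x∉U
    ... | no _     | yes refl = y∈S , y∉U
    ... | no z≢x   | no z≢y   = contradiction
          (subst (4 ≤_) (cubic a) (distinct≤∣p∣ (nb aw) (nb az) (nb ax) (nb ay)
            (z≢w ∘ sym) (λ { refl → w∉ x∈S }) (λ { refl → w∉ y∈S }) z≢x z≢y x≢y))
          (ℕₚ.<-irrefl refl)

  -- From a path-decomposition to a vertex order.

  module _ (D : PathDecomposition G) (width≤k : width D ≤ k) where

    -- S is an initial segment of an order of the vertices by first occurrence in a bag.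
    EarliestFirst : VSet → Set
    EarliestFirst S = ∀ x y j → x ∈ S → y ∉ S → y ∈ bag D j → ∃[ i ] (i Fin.≤ j × x ∈ bag D i)

    bag≤ : ∀ i → ∣ bag D i ∣ ≤ suc k
    bag≤ i = ≤-trans (≤-max (λ i → ∣ bag D i ∣) i) (∸⁻ width≤k)
      where
      ≤-max : ∀ {m} (f : Fin m → ℕ) i → f i ≤ foldr _⊔_ 0 f
      ≤-max f zero    = ℕₚ.m≤m⊔n (f zero) _
      ≤-max f (suc i) = ≤-trans (≤-max (f ∘ suc) i) (ℕₚ.m≤n⊔m (f zero) _)
      ∸⁻ : ∀ {m} → m ∸ 1 ≤ k → m ≤ suc k
      ∸⁻ {zero}  _ = z≤n
      ∸⁻ {suc m} p = s≤s p

    -- Take `v` from the first bag `t` that contains an unseen vertex. A seen vertex with an unseen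
    -- neighbour occurs no later than `t`, and again in a bag not before `t` together with that
    -- neighbour, hence in bag `t`. Removing `v` leaves at most `k` vertices as separator.
    next-vertex : ∀ {S} → EarliestFirst S → ∣ S ∣ < order G →
                  ∃[ v ] (v ∉ S × Separated S × EarliestFirst (S ⊕ v))
    next-vertex {S} initial ∣S∣<n
      with ∃∈∉ everything S (subst (∣ S ∣ <_) (sym (∣⊤∣≡n _)) ∣S∣<n)
    ... | x , _ , x∉ with least (λ i → any? λ v → ¬? (v ∈? S) ×-dec (v ∈? bag D i))
                            (proj₁ (vertices D x) , x , x∉ , proj₂ (vertices D x))
    ... | t , (v , v∉ , v∈t) , t-least =
      v , v∉ , (bag D t - v , ≤-size , sep) , initial′
      where
      ≤-size : ∣ bag D t - v ∣ ≤ k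
      ≤-size = s≤s⁻¹ (≤-trans (≤-reflexive (∣-∣ v∈t)) (bag≤ t))
      sep : ∀ x y → x ∈ S → y ∉ S → Adj G x y → x ∈ bag D t - v
      sep x y x∈ y∉ xy =
        let j , x∈j , y∈j = edges D x y xy
            i , i≤t , x∈i = initial x v t x∈ v∉ v∈t
        in x∈p∧x≢y⇒x∈p-y (interval D x i t j i≤t (t-least j (y , y∉ , y∈j)) x∈i x∈j)
                         λ { refl → v∉ x∈ }
      initial′ : EarliestFirst (S ⊕ v)
      initial′ x y j x∈ y∉ y∈j with ∈-⊕⁻ x∈
      ... | inj₁ x∈S  = initial x y j x∈S (y∉ ∘ ∈-⊕ˡ) y∈j
      ... | inj₂ refl = t , t-least j (y , y∉ ∘ ∈-⊕ˡ , y∈j) , v∈t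

    initial-segment : ∀ m → m ≤ order G → ∃[ S ] (∣ S ∣ ≡ m × EarliestFirst S)
    initial-segment zero    _   = ∅ , ∣⊥∣≡0 (order G) , λ _ _ _ x∈ → contradiction x∈ ∉⊥
    initial-segment (suc m) m<n =
      let S , size , initial = initial-segment m (ℕₚ.<⇒≤ m<n)
          v , v∉ , _ , initial′ = next-vertex initial (subst (_< order G) (sym size) m<n)
      in S ⊕ v , trans (∣⊕∣ S v∉) (cong suc size) , initial′

    layout-from : ∀ m {S} → m + ∣ S ∣ ≡ order G → EarliestFirst S → Layout S
    layout-from zero    eq initial = full λ x → subst (x ∈_) (sym (∣p∣≡n⇒p≡⊤ eq)) ∈⊤
    layout-from (suc m) {S} eq initial =
      let v , v∉ , sep , initial′ = next-vertex initial (≤-trans (s≤s (ℕₚ.m≤n+m _ m)) (≤-reflexive eq))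
      in add v sep v∉ (layout-from m
           (trans (cong (m +_) (∣⊕∣ S v∉)) (trans (ℕₚ.+-suc m _) eq)) initial′)

    -- The first `k + 1` vertices of the order form the first bag, and the rest of the order is the
    -- layout.
    initial-state : suc k ≤ order G → State (initialPair k)
    initial-state k<n =
      let S , size , initial = initial-segment (suc k) k<n
      in S , S , start size
         , layout-from (order G ∸ ∣ S ∣) (ℕₚ.m∸n+n≡m (∣p∣≤n S)) initial
         , copy-initial size

-- Path-decompositions of queued pairs, listed backwards from the current bag.

record Decomposed (k : ℕ) (P : Pair) : Set where
  field
    last     : ℕ
    bags     : Fin (suc last) → Subset (order (graph P))
    part≡    : bags zero ≡ part P
    size     : ∀ i → ∣ bags i ∣ ≤ suc k
    vertexBag : ∀ x → ∃[ i ] x ∈ bags i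
    edgeBag : ∀ x y → Adj (graph P) x y → ∃[ i ] (x ∈ bags i × y ∈ bags i)
    contiguous : ∀ x i j l → i Fin.≤ j → j Fin.≤ l → x ∈ bags i → x ∈ bags l → x ∈ bags j

initial-decomposed : ∀ k → Decomposed k (initialPair k)
initial-decomposed k = record
  { last     = 0
  ; bags     = λ _ → everything
  ; part≡    = refl
  ; size     = λ _ → ≤-reflexive (∣⊤∣≡n (suc k))
  ; vertexBag = λ _ → zero , ∈⊤
  ; edgeBag = λ _ _ ()
  ; contiguous = λ _ _ _ _ _ _ _ _ → ∈⊤
  }

-- The new bag is put in front. The new edges join `u` to other vertices of the previous bag, which
-- still contains `u` and now has index one.
extend-decomposed : ∀ {k P u Y} u∉Y → u ∈ part P → Y ⊆ (part P - u) → Decomposed k P →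
                    Decomposed k (extend P u Y u∉Y)
extend-decomposed {k} {P} {u} {Y} u∉Y u∈ Y⊆ d = record
  { last     = suc last
  ; bags     = bags′
  ; part≡    = refl
  ; size     = λ { zero → subst (_≤ suc k) (trans (cong ∣_∣ part≡) (sym (∣-∣ u∈))) (size zero)
                 ; (suc i) → size i }
  ; vertexBag = λ { zero → zero , here ; (suc x) → let i , x∈ = vertexBag x in suc i , there x∈ }
  ; edgeBag = λ { (suc x) (suc y) xy → edge x y (to (addVertex-adj (graph P) u Y u∉Y) xy) }
  ; contiguous = contiguous′
  }
  where
  open Decomposed d
  bags′ : Fin (suc (suc last)) → Subset (suc (order (graph P)))
  bags′ zero    = inside ∷ (part P - u)
  bags′ (suc i) = outside ∷ bags i
  U⊆ : ∀ {x} → x ∈ part P → x ∈ bags zero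
  U⊆ {x} = subst (x ∈_) (sym part≡)
  Y⊆U : ∀ {x} → x ∈ Y → x ∈ bags zero
  Y⊆U = U⊆ ∘ proj₁ ∘ ∈-minus⁻ ∘ Y⊆
  edge : ∀ x y → Adj (graph P) x y ⊎ (x ≡ u × y ∈ Y) ⊎ (y ≡ u × x ∈ Y) →
         ∃[ i ] (suc x ∈ bags′ i × suc y ∈ bags′ i)
  edge x y (inj₁ xy) = let i , x∈ , y∈ = edgeBag x y xy in suc i , there x∈ , there y∈
  edge x y (inj₂ (inj₁ (refl , y∈))) = suc zero , there (U⊆ u∈) , there (Y⊆U y∈)
  edge x y (inj₂ (inj₂ (refl , x∈))) = suc zero , there (Y⊆U x∈) , there (U⊆ u∈)
  contiguous′ : ∀ x i j l → i Fin.≤ j → j Fin.≤ l → x ∈ bags′ i → x ∈ bags′ l → x ∈ bags′ j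
  contiguous′ x zero zero l _ _ x∈ _ = x∈
  contiguous′ (suc x) zero (suc j) (suc l) _ (s≤s j≤l) (there x∈) (there x∈l) =
    there (contiguous x zero j l z≤n j≤l (U⊆ (proj₁ (∈-minus⁻ x∈))) x∈l)
  contiguous′ (suc x) (suc i) (suc j) (suc l) (s≤s i≤j) (s≤s j≤l) (there x∈i) (there x∈l) =
    there (contiguous x i j l i≤j j≤l x∈i x∈l)

-- The added edges lie inside `part P`, which is itself a bag, so the same bags serve.
decomposed⇒pathWidth : ∀ {k P} → Decomposed k P → (E : EdgeSet (part P)) →
                       PathWidthAtMost k (addEdges (graph P) E)
decomposed⇒pathWidth {k} {P} d E = record
  { length   = suc last
  ; bag      = bags
  ; vertices = vertexBag
  ; edges    = λ x y xy → [ edgeBag x y , (λ e → let x∈ , y∈ = EdgeSet.within E x y e in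
                   zero , U⊆ x∈ , U⊆ y∈) ]′ (to (T-∨ {adj (graph P) x y}) xy)
  ; interval = contiguous
  } , ℕₚ.∸-monoˡ-≤ 1 (max-≤ bags-size)
  where
  open Decomposed d renaming (size to bags-size)
  U⊆ : ∀ {x} → x ∈ part P → x ∈ bags zero
  U⊆ {x} = subst (x ∈_) (sym part≡)
  max-≤ : ∀ {m c} {f : Fin m → ℕ} → (∀ i → f i ≤ c) → foldr _⊔_ 0 f ≤ c
  max-≤ {zero}  f≤ = z≤n
  max-≤ {suc m} f≤ = ℕₚ.⊔-lub (f≤ zero) (max-≤ (f≤ ∘ suc))

-- Isomorphisms of graphs.

≅-sym : ∀ {G H} → G ≅ H → H ≅ G
≅-sym {G} {H} (φ , iso) = Perm.flip φ , λ x y →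
  trans (sym (iso (φ ⟨$⟩ˡ x) (φ ⟨$⟩ˡ y))) (cong₂ (adj H) (inverseʳ φ) (inverseʳ φ))

≅⇒containsCopy : ∀ {G H} → G ≅ H → ContainsCopy H G
≅⇒containsCopy (φ , iso) =
  (φ ⟨$⟩ʳ_)
  , ⟨$⟩ʳ-injective φ
  , λ x y → subst T (sym (iso x y))

-- Step (a), invariants of the queue, and soundness of a returned graph.

module Correctness (k : ℕ) (𝒢 : GraphClass) (𝒰 : List Graph) where

  open Algorithm k 𝒢 𝒰

  hit-resp-≅ : ∀ {P} {E E′ : EdgeSet (part P)} → addEdges (graph P) E′ ≅ addEdges (graph P) E →
               Hit P E → Hit P E′
  hit-resp-≅ {P} {E} {E′} E′≅E (member , ¬super) =
    closed 𝒢 (≅-sym {H′} {H} E′≅E) member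
    , ¬super ∘ super-mono {𝒰} {H} {H′} (≅⇒containsCopy {H′} {H} E′≅E)
    where
    H  = addEdges (graph P) E
    H′ = addEdges (graph P) E′

  -- A discarded set equals the tested one or is its image under an automorphism. Either way it
  -- gives an isomorphic graph, and being a hit is invariant under isomorphism.
  stepA-complete : ∀ {P 𝓕 r} → StepA P 𝓕 r → r ≡ nothing → ∀ E → 𝓕 E → ¬ Hit P E
  stepA-complete (exhausted empty) _ E E∈ hit = empty E E∈
  stepA-complete {P} (discard E′ _ ¬hit rest) r≡ E E∈ hit = stepA-complete rest r≡ E
    ( E∈
    , (λ E≐E′ → ¬hit (hit-resp-≅ {P} {E} {E′}
        (Perm.id , λ x y → cong (adj (graph P) x y ∨_) (E≐E′ x y)) hit))
    , (λ ((φ , iso) , image) → ¬hit (hit-resp-≅ {P} {E} {E′}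
        (φ , λ x y → cong₂ _∨_ (IsPairIso.graphIso iso x y) (image x y)) hit)))
    hit

  stepA-sound : ∀ {P 𝓕 r G} → StepA P 𝓕 r → r ≡ just G → ∃[ E ] (Hit P E × G ≡ addEdges (graph P) E)
  stepA-sound (return E _ hit)     refl = E , hit , refl
  stepA-sound (discard _ _ _ rest) r≡   = stepA-sound rest r≡

  append-all : ∀ {P Q P′ Q′} {R : Pred Pair 0ℓ} → Append P Q P′ Q′ → R P′ → All R Q → All R Q′
  append-all (append _) r rs = All.∷ʳ⁺ rs r
  append-all (skip _)   r rs = rs

  append-any : ∀ {P Q P′ Q′} {R : Pred Pair 0ℓ} → Append P Q P′ Q′ → Any R Q → Any R Q′
  append-any (append _) = Any.++⁺ˡ
  append-any (skip _)   = id

  loopY-any : ∀ {P u 𝒴 Q Q′} {R : Pred Pair 0ℓ} → LoopY P u 𝒴 Q Q′ → Any R Q → Any R Q′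
  loopY-any (done _)              = id
  loopY-any (step _ _ _ app rest) = loopY-any rest ∘ append-any app

  loopU-any : ∀ {P W Q Q′} {R : Pred Pair 0ℓ} → LoopU P W Q Q′ → Any R Q → Any R Q′
  loopU-any (done _)               = id
  loopU-any (step _ _ loopY rest) = loopU-any rest ∘ loopY-any loopY

  stepB-any : ∀ {P Q Q′} {R : Pred Pair 0ℓ} → StepB P Q Q′ → Any R Q → Any R Q′
  stepB-any (stepB _ loopU) = loopU-any loopU

  candidates⊆ : ∀ {P W} → Candidates P W → W ⊆ part P
  candidates⊆ {P} (single u u∈ _) x∈ = subst (_∈ part P) (sym (x∈⁅y⁆⇒x≡y u x∈)) u∈
  candidates⊆ (orbits W _ transversal)  = IsTransversal.within transversal

  loopY-decomposed : ∀ {P u 𝒴 Q Q′} → Decomposed k P → u ∈ part P → (∀ Y → 𝒴 Y → Y ⊆ (part P - u)) →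
                     LoopY P u 𝒴 Q Q′ → All (Decomposed k) Q → All (Decomposed k) Q′
  loopY-decomposed d u∈ 𝒴⊆ (done _) ds = ds
  loopY-decomposed d u∈ 𝒴⊆ (step Y u∉Y Y∈ app rest) ds =
    loopY-decomposed d u∈ (λ Z → 𝒴⊆ Z ∘ proj₁) rest
      (append-all app (extend-decomposed u∉Y u∈ (𝒴⊆ Y Y∈) d) ds)

  loopU-decomposed : ∀ {P W Q Q′} → Decomposed k P → W ⊆ part P →
                     LoopU P W Q Q′ → All (Decomposed k) Q → All (Decomposed k) Q′
  loopU-decomposed d W⊆ (done _) ds = ds
  loopU-decomposed {P} d W⊆ (step u u∈ loopY rest) ds =
    loopU-decomposed d (W⊆ ∘ proj₁ ∘ ∈-minus⁻) rest
      (loopY-decomposed {𝒴 = _⊆ (part P - u)} d (W⊆ u∈) (λ _ Y⊆ → Y⊆) loopY ds)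

  Returnable : Graph → Set
  Returnable G = 𝒢ᵏ G × ¬ Super 𝒰 G

  -- Every queued pair keeps a decomposition with its part as a bag. Thus the queue bounds the
  -- path-width, while the hit gives membership and the absence of forbidden subgraphs.
  loop-sound : ∀ {Q r G} → Loop Q r → r ≡ just G → All (Decomposed k) Q → Returnable G
  loop-sound (found Q₁ P Q₂ stepA) refl ds with stepA-sound stepA refl
  ... | E , (member , ¬super) , refl =
    (member , decomposed⇒pathWidth (All.head (All.++⁻ʳ Q₁ ds)) E) , ¬super
  loop-sound (continue Q₁ P Q₂ _ (stepB candidates loopU) rest) r≡ ds
    with All.++⁻ Q₁ ds
  ... | ds₁ , d ∷ ds₂ =
    loop-sound rest r≡ (loopU-decomposed d (candidates⊆ candidates) loopU (All.++⁺ ds₁ ds₂))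

  -- Completeness: a missed graph keeps a state in the queue.

  module _ (cubic : ∀ G → Member 𝒢 G → Cubic G)
           (G : Graph) (member : Member 𝒢 G) (¬super : ¬ Super 𝒰 G) where

    open Search k G
    open Copies k G

    -- Once all vertices have been seen, the graph of `P` lacks only the edges inside the bag; `E`
    -- restores them and the result is isomorphic to `G`.
    complete-copy⇒hit : ∀ {P S U} → Copy P S U → (∀ x → x ∈ S) → ∃ (Hit P)
    complete-copy⇒hit {P} {S} {U} c all = E ,
      ( closed 𝒢 (≅-sym {H} {G} H≅G) member
      , ¬super ∘ super-mono {𝒰} {G} {H} (≅⇒containsCopy {H} {G} H≅G))
      where
      open Copy c
      inner : Vertex (graph P) → Vertex (graph P) → Bool
      inner x y = ⌊ x ∈? part P ⌋ ∧ ⌊ y ∈? part P ⌋ ∧ adj G (name x) (name y)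
      inner⁻ : ∀ x y → T (inner x y) → x ∈ part P × y ∈ part P × Adj G (name x) (name y)
      inner⁻ x y t =
        let x∈ , t′ = to (T-∧ {⌊ x ∈? part P ⌋}) t
            y∈ , xy = to (T-∧ {⌊ y ∈? part P ⌋}) t′
        in toWitness {a? = x ∈? part P} x∈ , toWitness {a? = y ∈? part P} y∈ , xy
      inner⁺ : ∀ {x y} → x ∈ part P → y ∈ part P → Adj G (name x) (name y) → T (inner x y)
      inner⁺ {x} {y} x∈ y∈ xy = from (T-∧ {⌊ x ∈? part P ⌋})
        (fromWitness x∈ , from (T-∧ {⌊ y ∈? part P ⌋}) (fromWitness y∈ , xy))
      flip-inner : ∀ x y → T (inner x y) → T (inner y x)
      flip-inner x y t = let x∈ , y∈ , xy = inner⁻ x y t in inner⁺ y∈ x∈ (adj-sym G xy)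
      E : EdgeSet (part P)
      E = record
        { mem         = inner
        ; symmetric   = λ x y → T-ext (flip-inner x y) (flip-inner y x)
        ; irreflexive = λ x → T-ext (λ t → adj-irr G (proj₂ (proj₂ (inner⁻ x x t)))) λ ()
        ; within      = λ x y t → let x∈ , y∈ , _ = inner⁻ x y t in x∈ , y∈
        }
      H = addEdges (graph P) E
      unname : Vertex G → Vertex (graph P)
      unname y = proj₁ (to (onto y) (all y))
      name-unname : ∀ y → name (unname y) ≡ y
      name-unname y = proj₂ (to (onto y) (all y))
      edges⁺ : ∀ x y → Adj G (name x) (name y) → Adj (graph P) x y ⊎ T (inner x y)
      edges⁺ x y xy with x ∈? part P | y ∈? part P
      ... | no x∉  | _      = inj₁ (from (adj⇔ x y) (xy , x∉ ∘ from (part⇔ x) ∘ proj₁))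
      ... | yes _  | no y∉  = inj₁ (from (adj⇔ x y) (xy , y∉ ∘ from (part⇔ y) ∘ proj₂))
      ... | yes _  | yes _  = inj₂ xy
      H≅G : H ≅ G
      H≅G = permutation name unname name-unname (λ x → injective (name-unname (name x)))
          , λ x y → T-ext (from (T-∨ {adj (graph P) x y}) ∘ edges⁺ x y)
                          ([ proj₁ ∘ to (adj⇔ x y) , (λ t → proj₂ (proj₂ (inner⁻ x y t))) ]′
                            ∘ to (T-∨ {adj (graph P) x y}))

    -- A state passes the first two tests, so it is refused only if an isomorphic pair is queued,
    -- and that pair is a state too. The double negation reflects that acceptance comes without a
    -- decision.
    append-reaches : ∀ {P Q P′ Q′} → State P′ → Append P Q P′ Q′ → ¬ ¬ Any State Q′
    append-reaches {Q = Q} s (append _) ¬any = ¬any (Any.++⁺ʳ Q (here s))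
    append-reaches {P′ = P′} (S , U , past , layout , c) (skip ¬accept) ¬any = ¬accept
      ( ¬super ∘ super-mono {𝒰} {G} {graph P′} (copy⇒subgraph c)
      , (G , member , copy⇒containsPair past layout c)
      , ¬any ∘ Any.map λ P′≅R → S , U , past , layout , copy-pull (≅ₚ-sym P′≅R) c)

    -- If `Y` is removed on behalf of another set, an automorphism fixing `u` relates the two, and
    -- the extension by that set is a state as well.
    loopY-reaches : ∀ {P u 𝒴 Q Q′} Y (u∉Y : u ∉ Y) → State (extend P u Y u∉Y) → 𝒴 Y →
                    LoopY P u 𝒴 Q Q′ → ¬ ¬ Any State Q′
    loopY-reaches Y u∉Y s Y∈ (done empty) _ = empty Y Y∈
    loopY-reaches {P} {u} Y u∉Y s@(S , U , past , layout , c) Y∈ (step Z u∉Z _ app rest) ¬any =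
      -- The goal is a negation, so the case distinction on automorphic images is admissible.
      ¬¬-excluded-middle {A = Σ[ φ ∈ Aut P ] (act φ u ≡ u × IsImage P φ Z Y)} λ
        { (yes (φ , φu , image)) →
            append-reaches (S , U , past , layout , copy-pull (extend-≅ u∉Z u∉Y φ φu image) c) app
              (¬any ∘ loopY-any rest)
        ; (no ¬image) → loopY-reaches Y u∉Y s
            ( Y∈
            , (λ { refl → ¬image (identity , refl , λ x → mk⇔ id id) })
            , ¬image) rest ¬any }
      where
      identity : Aut P
      identity = Perm.id , record { graphIso = λ _ _ → refl ; partIso = λ _ → mk⇔ id id }

    loopU-reaches : ∀ {P W u Q Q′} → u ∈ W → Extension P u State → LoopU P W Q Q′ → ¬ ¬ Any State Q′
    loopU-reaches {u = u} u∈ ext (done empty) _ = empty (u , u∈)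
    loopU-reaches {P} {u = u} u∈ ext@(Y , Y⊆ , u∉Y , s) (step w w∈ loopY rest) ¬any with u ≟ w
    ... | yes refl = loopY-reaches {𝒴 = _⊆ (part P - u)} Y u∉Y s Y⊆ loopY (¬any ∘ loopU-any rest)
    ... | no u≢w   = loopU-reaches (x∈p∧x≢y⇒x∈p-y u∈ u≢w) ext rest ¬any

    -- If everything has been seen, step (a) would have returned a graph. A prescribed vertex of
    -- degree at least two is handled by `state-extend-at`; otherwise some vertex of the bag can
    -- leave, and so can the representative of its orbit.
    candidates-extend : ∀ {P W} → State P → StepA P Univ nothing → Candidates P W →
                        ∃[ u ] (u ∈ W × Extension P u State)
    candidates-extend (S , U , past , full all , c) stepA _ =
      let E , hit = complete-copy⇒hit c all in contradiction hit (stepA-complete stepA refl E _)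
    candidates-extend (S , U , past , layout@(add v _ v∉ layout′) , c) _ (single u u∈ deg) =
      u , x∈⁅x⁆ u , state-extend-at (cubic G member) past c u∈ deg layout v∉ layout′
    candidates-extend (S , U , past , add v sep v∉ layout′ , c) _ (orbits W _ transversal)
      with removable (past⇒front past) sep
    ... | a , a∈ , closed-a with to (Copy.onto c a) (IsFront.within (past⇒front past) a∈)
    ...   | x , refl with IsTransversal.meets transversal x (from (Copy.part⇔ c x) a∈)
    ...     | w , w∈ , φ , refl =
      w , w∈ , state-extend past c′ (IsTransversal.within transversal w∈)
                 (subst (ClosedAt S ∘ Copy.name c) (sym (inverseˡ (proj₁ φ))) closed-a) v∉ layout′
      -- Renaming by the inverse of the automorphism gives the representative the name of the
      -- removable vertex.
      where c′ = copy-pull (≅ₚ-sym φ) c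

    -- Processing another pair leaves the state in the queue, and processing the state itself brings
    -- in a new one, so the queue never becomes empty.
    loop-complete : ∀ {Q r} → Loop Q r → r ≡ nothing → ¬ Any State Q
    loop-complete none _ ()
    loop-complete (continue Q₁ P Q₂ stepA step-B@(stepB candidates loopU) rest) r≡ any
      with Any.++⁻ Q₁ any
    ... | inj₁ any₁         = loop-complete rest r≡ (stepB-any step-B (Any.++⁺ˡ any₁))
    ... | inj₂ (there any₂) = loop-complete rest r≡ (stepB-any step-B (Any.++⁺ʳ Q₁ any₂))
    ... | inj₂ (here s)     =
      let u , u∈ , ext = candidates-extend s stepA candidates
      in loopU-reaches u∈ ext loopU (loop-complete rest r≡)

    execution-complete : suc k ≤ order G → PathWidthAtMost k G → ¬ Execution nothing
    execution-complete k<n (D , width≤k) (execution initial loop) with initial-state D width≤k k<n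
    ... | s@(_ , _ , past , layout , c) = case initial loop
      where
      case : ∀ {Q} → Initial Q → Loop Q nothing → ⊥
      case (keep _)    loop = loop-complete loop refl (here s)
      -- The graph contains the initial pair, so goodness of that pair would put it in `Super 𝒰`.
      case (drop good) loop = ¬super (good G (member , D , width≤k) (copy⇒containsPair past layout c))

theorem12 : (k : ℕ) (𝒢 : GraphClass) (𝒰 : List Graph) →
    (∀ G → Member 𝒢 G → Cubic G) →
    (∀ G → Member 𝒢 G → suc k ≤ order G) →
    (r : Maybe Graph) → Algorithm.Execution k 𝒢 𝒰 r →
    (∀ G → r ≡ just G → Algorithm.𝒢ᵏ k 𝒢 𝒰 G × ¬ Super 𝒰 G) ×
    (r ≡ nothing → ∀ G → Algorithm.𝒢ᵏ k 𝒢 𝒰 G → Super 𝒰 G)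
theorem12 k 𝒢 𝒰 cubic order≥ r run = sound run , complete run
  where
  open Algorithm k 𝒢 𝒰
  open Correctness k 𝒢 𝒰
  sound : Execution r → ∀ G → r ≡ just G → 𝒢ᵏ G × ¬ Super 𝒰 G
  sound (execution (keep _) loop) G r≡ = loop-sound loop r≡ (initial-decomposed k ∷ [])
  sound (execution (drop _) loop) G r≡ = loop-sound loop r≡ []
  complete : Execution r → r ≡ nothing → ∀ G → 𝒢ᵏ G → Super 𝒰 G
  complete run refl G (member , pw) = decidable-stable (super? 𝒰 G) λ ¬super →
    execution-complete cubic G member ¬super (order≥ G member) pw run
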